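{- Let $r,d,m,p$ be positive integers. Then there exists $c>0$ such that the following holds. Let $H$ be the complete $r$-uniform hypergraph on $N$ vertices, whose edges are colored with $p$ colors (every edge receiving at least one, possibly more than one, color) such that each color class is semi-algebraic of complexity $(d,1,m)$. Then $H$ contains a monochromatic clique of size at least $(\log N)^{c}$.
   Context: An $r$-uniform hypergraph $G$ is semi-algebraic of complexity $(d,D,m)$ if there is an enumeration $v_1,\dots,v_N$ of its vertices, an assignment $v_i\mapsto p_i\in\mathbb{R}^d$ for $i\in\{1,\dots,N\}$, $m$ polynomials $f_1,\dots,f_m:(\mathbb{R}^d)^r\to\mathbb{R}$ of (total) degree at most $D$, and a function $\Phi:\{+,-,0\}^m\to\{\text{True},\text{False}\}$ such that for all $1\le i_1<\dots<i_r\le N$, the set $\{v_{i_1},\dots,v_{i_r}\}$ is an edge of $G$ if and only if $\Phi(\operatorname{sign}(f_1(p_{i_1},\dots,p_{i_r})),\dots,\operatorname{sign}(f_m(p_{i_1},\dots,p_{i_r})))=\text{True}$, where $\operatorname{sign}(x)\in\{+,-,0\}$ is the sign of $x$. The color class of a color is the $r$-uniform hypergraph on the whole vertex set whose edges are the $r$-element sets receiving that color. A monochromatic clique is a set $C$ of vertices for which there is a color $\kappa$ such that every $r$-element subset of $C$ has $\kappa$ among its colors.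
   Formalization: For r = 1 the formal theorem assumes N ≤ 2 or N > p: if r = 1 and 3 ≤ N ≤ p, coloring each vertex with its own color leaves only monochromatic cliques of size 1 < (log N)^c, so the claim as stated fails. Nothing is changed for r ≥ 2. -}

module Defs where

open import Data.Bool.Base using (Bool; T)
open import Data.Fin.Base as Fin using (Fin)
open import Data.Fin.Permutation using (Permutation′; _⟨$⟩ʳ_)
open import Data.Fin.Subset using (Subset; _∈_; _⊆_; ∣_∣; ⁅_⁆; ⋃; Nonempty)
open import Data.Integer.Base as ℤ using ()
open import Data.List.Base as List using (List; []; _∷_)
open import Data.List.Relation.Unary.All using (All)
open import Data.Nat.Base as ℕ using (ℕ; zero; suc)
import Data.Nat.Properties as ℕ
open import Data.Product.Base using (∃; _×_; _,_; proj₁; proj₂)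
open import Data.Rational.Base as ℚ using (ℚ; 0ℚ; 1ℚ; ½; ↥_; ↧ₙ_)
import Data.Rational.Properties as ℚ
open import Data.Rational.Solver using (module +-*-Solver)
open import Data.Vec.Base as Vec using (Vec; []; _∷_; lookup)
open import Function.Bundles using (_⇔_)
open import Relation.Binary.PropositionalEquality
  using (_≡_; refl; sym; trans; cong; cong₂; subst)

------------------------------------------------------------------------
-- Real numbers, as Cauchy sequences of rationals

Eventually : (ℕ → Set) → Set
Eventually P = ∃ λ M → ∀ n → M ℕ.≤ n → P n

Cauchy : (ℕ → ℚ) → Set
Cauchy x = ∀ ε → 0ℚ ℚ.< ε →
  ∃ λ M → ∀ m n → M ℕ.≤ m → M ℕ.≤ n → ℚ.∣ x m ℚ.- x n ∣ ℚ.< ε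

record ℝ : Set where
  constructor mkℝ
  field
    seq    : ℕ → ℚ
    cauchy : Cauchy seq

open ℝ public

-- Propositional equality on ℝ compares representatives; equality of real
-- numbers is _≃_.

infix 4 _≃_ _<_

_≃_ : ℝ → ℝ → Set
x ≃ y = ∀ ε → 0ℚ ℚ.< ε → Eventually λ n → ℚ.∣ seq x n ℚ.- seq y n ∣ ℚ.< ε

_<_ : ℝ → ℝ → Set
x < y = ∃ λ ε → 0ℚ ℚ.< ε × Eventually λ n → seq x n ℚ.+ ε ℚ.< seq y n

fromℚ : ℚ → ℝ
fromℚ q = mkℝ (λ _ → q) λ ε ε>0 →
  0 , λ _ _ _ _ → subst (λ t → ℚ.∣ t ∣ ℚ.< ε) (sym (ℚ.+-inverseʳ q)) ε>0

0ℝ 1ℝ : ℝ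
0ℝ = fromℚ 0ℚ
1ℝ = fromℚ 1ℚ

private
  abstract
    half+half : ∀ ε → ½ ℚ.* ε ℚ.+ ½ ℚ.* ε ≡ ε
    half+half ε = trans (sym (ℚ.*-distribʳ-+ ε ½ ½)) (ℚ.*-identityˡ ε)

    half>0 : ∀ {ε} → 0ℚ ℚ.< ε → 0ℚ ℚ.< ½ ℚ.* ε
    half>0 {ε} ε>0 = subst (ℚ._< ½ ℚ.* ε) (ℚ.*-zeroʳ ½) (ℚ.*-monoʳ-<-pos ½ ε>0)

    +-cauchy : ∀ x y → Cauchy x → Cauchy y → Cauchy (λ n → x n ℚ.+ y n)
    +-cauchy x y cx cy ε ε>0
      with cx (½ ℚ.* ε) (half>0 ε>0) | cy (½ ℚ.* ε) (half>0 ε>0)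
    ... | M₁ , h₁ | M₂ , h₂ = M₁ ℕ.⊔ M₂ , λ m n M≤m M≤n →
      let open ℚ.≤-Reasoning in begin-strict
        ℚ.∣ (x m ℚ.+ y m) ℚ.- (x n ℚ.+ y n) ∣
          ≡⟨ cong ℚ.∣_∣ (rearrange (x m) (y m) (x n) (y n)) ⟩
        ℚ.∣ (x m ℚ.- x n) ℚ.+ (y m ℚ.- y n) ∣
          ≤⟨ ℚ.∣p+q∣≤∣p∣+∣q∣ (x m ℚ.- x n) (y m ℚ.- y n) ⟩
        ℚ.∣ x m ℚ.- x n ∣ ℚ.+ ℚ.∣ y m ℚ.- y n ∣
          <⟨ ℚ.+-mono-<
               (h₁ m n (ℕ.m⊔n≤o⇒m≤o M₁ M₂ M≤m) (ℕ.m⊔n≤o⇒m≤o M₁ M₂ M≤n))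
               (h₂ m n (ℕ.m⊔n≤o⇒n≤o M₁ M₂ M≤m) (ℕ.m⊔n≤o⇒n≤o M₁ M₂ M≤n)) ⟩
        ½ ℚ.* ε ℚ.+ ½ ℚ.* ε
          ≡⟨ half+half ε ⟩
        ε ∎
      where
      rearrange : ∀ a b c d → (a ℚ.+ b) ℚ.- (c ℚ.+ d) ≡ (a ℚ.- c) ℚ.+ (b ℚ.- d)
      rearrange = solve 4 (λ a b c d →
        (a :+ b) :- (c :+ d) := (a :- c) :+ (b :- d)) refl
        where open +-*-Solver

    cauchy⇒bounded : ∀ {x} → Cauchy x →
      ∃ λ B → 0ℚ ℚ.< B × Eventually λ n → ℚ.∣ x n ∣ ℚ.≤ B
    cauchy⇒bounded {x} cx with cx 1ℚ (ℚ.positive⁻¹ 1ℚ)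
    ... | M , h =
      ℚ.∣ x M ∣ ℚ.+ 1ℚ ,
      ℚ.+-mono-≤-< (ℚ.0≤∣p∣ (x M)) (ℚ.positive⁻¹ 1ℚ) ,
      M , λ n M≤n → let open ℚ.≤-Reasoning in begin
        ℚ.∣ x n ∣
          ≡⟨ cong ℚ.∣_∣ (split (x n) (x M)) ⟩
        ℚ.∣ x M ℚ.+ (x n ℚ.- x M) ∣
          ≤⟨ ℚ.∣p+q∣≤∣p∣+∣q∣ (x M) (x n ℚ.- x M) ⟩
        ℚ.∣ x M ∣ ℚ.+ ℚ.∣ x n ℚ.- x M ∣
          ≤⟨ ℚ.+-monoʳ-≤ ℚ.∣ x M ∣ (ℚ.<⇒≤ (h n M M≤n ℕ.≤-refl)) ⟩
        ℚ.∣ x M ∣ ℚ.+ 1ℚ ∎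
      where
      split : ∀ a b → a ≡ b ℚ.+ (a ℚ.- b)
      split = solve 2 (λ a b → a := b :+ (a :- b)) refl
        where open +-*-Solver

    divide : ∀ B → 0ℚ ℚ.< B → ∀ ε → 0ℚ ℚ.< ε →
      ∃ λ δ → 0ℚ ℚ.< δ × B ℚ.* δ ≡ ε
    divide B B>0 ε ε>0 = B⁻¹ ℚ.* ε , δ>0 , eq
      where
      instance
        posB : ℚ.Positive B
        posB = ℚ.positive B>0
        nzB : ℚ.NonZero B
        nzB = ℚ.pos⇒nonZero B
      B⁻¹ : ℚ
      B⁻¹ = ℚ.1/ B
      δ>0 : 0ℚ ℚ.< B⁻¹ ℚ.* ε
      δ>0 = subst (ℚ._< B⁻¹ ℚ.* ε) (ℚ.*-zeroʳ B⁻¹)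
              (ℚ.*-monoʳ-<-pos B⁻¹ {{ℚ.1/pos⇒pos B}} ε>0)
      eq : B ℚ.* (B⁻¹ ℚ.* ε) ≡ ε
      eq = trans (sym (ℚ.*-assoc B B⁻¹ ε))
             (trans (cong (ℚ._* ε) (ℚ.*-inverseʳ B)) (ℚ.*-identityˡ ε))

    *-bound : ∀ a b B δ → 0ℚ ℚ.< B → ℚ.∣ a ∣ ℚ.≤ B → ℚ.∣ b ∣ ℚ.< δ →
      ℚ.∣ a ℚ.* b ∣ ℚ.< B ℚ.* δ
    *-bound a b B δ B>0 a≤B b<δ =
      let open ℚ.≤-Reasoning in begin-strict
        ℚ.∣ a ℚ.* b ∣          ≡⟨ ℚ.∣p*q∣≡∣p∣*∣q∣ a b ⟩
        ℚ.∣ a ∣ ℚ.* ℚ.∣ b ∣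
          ≤⟨ ℚ.*-monoʳ-≤-nonNeg ℚ.∣ b ∣ {{ℚ.∣-∣-nonNeg b}} a≤B ⟩
        B ℚ.* ℚ.∣ b ∣
          <⟨ ℚ.*-monoʳ-<-pos B {{ℚ.positive B>0}} b<δ ⟩
        B ℚ.* δ ∎

    *-close : ∀ a b c d A δ D η → 0ℚ ℚ.< A → 0ℚ ℚ.< D →
      ℚ.∣ a ∣ ℚ.≤ A → ℚ.∣ b ℚ.- d ∣ ℚ.< δ →
      ℚ.∣ d ∣ ℚ.≤ D → ℚ.∣ a ℚ.- c ∣ ℚ.< η →
      ℚ.∣ a ℚ.* b ℚ.- c ℚ.* d ∣ ℚ.< A ℚ.* δ ℚ.+ D ℚ.* η
    *-close a b c d A δ D η A>0 D>0 a≤A b-d<δ d≤D a-c<η =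
      let open ℚ.≤-Reasoning in begin-strict
        ℚ.∣ a ℚ.* b ℚ.- c ℚ.* d ∣
          ≡⟨ cong ℚ.∣_∣ (rearrange a b c d) ⟩
        ℚ.∣ a ℚ.* (b ℚ.- d) ℚ.+ d ℚ.* (a ℚ.- c) ∣
          ≤⟨ ℚ.∣p+q∣≤∣p∣+∣q∣ (a ℚ.* (b ℚ.- d)) (d ℚ.* (a ℚ.- c)) ⟩
        ℚ.∣ a ℚ.* (b ℚ.- d) ∣ ℚ.+ ℚ.∣ d ℚ.* (a ℚ.- c) ∣
          <⟨ ℚ.+-mono-< (*-bound a (b ℚ.- d) A δ A>0 a≤A b-d<δ)
                        (*-bound d (a ℚ.- c) D η D>0 d≤D a-c<η) ⟩
        A ℚ.* δ ℚ.+ D ℚ.* η ∎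
      where
      rearrange : ∀ a b c d →
        a ℚ.* b ℚ.- c ℚ.* d ≡ a ℚ.* (b ℚ.- d) ℚ.+ d ℚ.* (a ℚ.- c)
      rearrange = solve 4 (λ a b c d →
        a :* b :- c :* d := a :* (b :- d) :+ d :* (a :- c)) refl
        where open +-*-Solver

    *-cauchy : ∀ x y → Cauchy x → Cauchy y → Cauchy (λ n → x n ℚ.* y n)
    *-cauchy x y cx cy ε ε>0 =
      let A , A>0 , M₁ , x≤A = cauchy⇒bounded cx
          D , D>0 , M₂ , y≤D = cauchy⇒bounded cy
          δ , δ>0 , Aδ≡½ε = divide A A>0 (½ ℚ.* ε) (half>0 ε>0)
          η , η>0 , Dη≡½ε = divide D D>0 (½ ℚ.* ε) (half>0 ε>0)
          M₃ , y-close = cy δ δ>0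
          M₄ , x-close = cx η η>0
          M₁₂ = M₁ ℕ.⊔ M₂
          M₃₄ = M₃ ℕ.⊔ M₄
          fst₁₂ = λ {k} (M≤k : M₁₂ ℕ.⊔ M₃₄ ℕ.≤ k) → ℕ.m⊔n≤o⇒m≤o M₁₂ M₃₄ M≤k
          snd₃₄ = λ {k} (M≤k : M₁₂ ℕ.⊔ M₃₄ ℕ.≤ k) → ℕ.m⊔n≤o⇒n≤o M₁₂ M₃₄ M≤k
      in M₁₂ ℕ.⊔ M₃₄ , λ m n M≤m M≤n →
        subst (ℚ.∣ x m ℚ.* y m ℚ.- x n ℚ.* y n ∣ ℚ.<_)
          (trans (cong₂ ℚ._+_ Aδ≡½ε Dη≡½ε) (half+half ε))
          (*-close (x m) (y m) (x n) (y n) A δ D η A>0 D>0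
            (x≤A m (ℕ.m⊔n≤o⇒m≤o M₁ M₂ (fst₁₂ M≤m)))
            (y-close m n (ℕ.m⊔n≤o⇒m≤o M₃ M₄ (snd₃₄ M≤m))
                         (ℕ.m⊔n≤o⇒m≤o M₃ M₄ (snd₃₄ M≤n)))
            (y≤D n (ℕ.m⊔n≤o⇒n≤o M₁ M₂ (fst₁₂ M≤n)))
            (x-close m n (ℕ.m⊔n≤o⇒n≤o M₃ M₄ (snd₃₄ M≤m))
                         (ℕ.m⊔n≤o⇒n≤o M₃ M₄ (snd₃₄ M≤n))))

infixl 6 _+_
infixl 7 _*_
infixr 8 _^_

_+_ : ℝ → ℝ → ℝ
x + y = mkℝ (λ n → seq x n ℚ.+ seq y n) (+-cauchy (seq x) (seq y) (cauchy x) (cauchy y))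

_*_ : ℝ → ℝ → ℝ
x * y = mkℝ (λ n → seq x n ℚ.* seq y n) (*-cauchy (seq x) (seq y) (cauchy x) (cauchy y))

_^_ : ℝ → ℕ → ℝ
x ^ zero  = 1ℝ
x ^ suc k = x * x ^ k

data Sign : Set where
  pos neg zer : Sign

-- sign x = s.  This is a relation because a function ℝ → Sign would decide
-- equality of real numbers; x determines s uniquely, and classically every x
-- has a sign.
HasSign : ℝ → Sign → Set
HasSign x pos = 0ℝ < x
HasSign x neg = x < 0ℝ
HasSign x zer = x ≃ 0ℝ

------------------------------------------------------------------------
-- Polynomials in n variables, as sums of terms a · x₁^e₁ ⋯ xₙ^eₙ

Polynomial : ℕ → Set
Polynomial n = List (ℝ × Vec ℕ n)

evalTerm : ∀ {n} → ℝ × Vec ℕ n → Vec ℝ n → ℝ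
evalTerm (a , e) x = a * Vec.foldr′ _*_ 1ℝ (Vec.zipWith _^_ x e)

eval : ∀ {n} → Polynomial n → Vec ℝ n → ℝ
eval f x = List.foldr (λ t s → evalTerm t x + s) 0ℝ f

DegreeAtMost : ∀ {n} → ℕ → Polynomial n → Set
DegreeAtMost D = All λ (_ , e) → Vec.sum e ℕ.≤ D

------------------------------------------------------------------------
-- Hypergraphs; the vertex set is Fin N

record Hypergraph (r N : ℕ) : Set₁ where
  field
    Edge    : Subset N → Set
    uniform : ∀ {e} → Edge e → ∣ e ∣ ≡ r

open Hypergraph public

Increasing : ∀ {r N} → (Fin r → Fin N) → Set
Increasing i = ∀ {a b} → a Fin.< b → i a Fin.< i b

-- { v 0 , … , v (r - 1) }
setOf : ∀ {r N} → (Fin r → Fin N) → Subset N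
setOf v = ⋃ (List.tabulate λ k → ⁅ v k ⁆)

record SemiAlgebraic {r N : ℕ} (d D m : ℕ) (G : Hypergraph r N) : Set where
  field
    enum   : Permutation′ N
    point  : Fin N → Vec ℝ d
    -- (ℝ^d)^r is identified with ℝ^(r d) by concatenating the r blocks.
    f      : Fin m → Polynomial (r ℕ.* d)
    degree : ∀ j → DegreeAtMost D (f j)
    Φ      : Vec Sign m → Bool
    -- σ ranges over the vectors of signs of f₁, …, f_m at the chosen points;
    -- classically there is exactly one.
    edge⇔Φ : ∀ (i : Fin r → Fin N) → Increasing i → ∀ (σ : Vec Sign m) →
      (∀ j → HasSign (eval (f j) (Vec.concat (Vec.tabulate λ k → point (i k))))
                     (lookup σ j)) →
      Edge G (setOf λ k → enum ⟨$⟩ʳ i k) ⇔ T (Φ σ)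

-- A colouring of the edges of the complete r-uniform hypergraph with p
-- colours.  The values of colours on sets of size other than r are never used.
record Colouring (r N p : ℕ) : Set where
  field
    colours  : Subset N → Subset p
    nonempty : ∀ e → ∣ e ∣ ≡ r → Nonempty (colours e)

open Colouring public

colourClass : ∀ {r N p} → Colouring r N p → Fin p → Hypergraph r N
colourClass {r} χ κ = record
  { Edge    = λ e → ∣ e ∣ ≡ r × κ ∈ colours χ e
  ; uniform = proj₁
  }

MonochromaticClique : ∀ {r N p} → Colouring r N p → Subset N → Set
MonochromaticClique {r} χ C =
  ∃ λ κ → ∀ e → e ⊆ C → ∣ e ∣ ≡ r → κ ∈ colours χ e

-- (log₂ N)^c ≤ s for N ≥ 1 and rational c = a / b > 0, that is,
-- (log₂ N)^a ≤ s^b.  Here log₂ N is given by its lower cut: a rational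
-- u / v ≥ 0 lies below log₂ N iff 2^u ≤ N^v.
LogPower≤ : ℕ → ℚ → ℕ → Set
LogPower≤ N c s = ∀ u v → 1 ℕ.≤ v → 2 ℕ.^ u ℕ.≤ N ℕ.^ v →
  u ℕ.^ a ℕ.≤ s ℕ.^ b ℕ.* v ℕ.^ a
  where
  a b : ℕ
  a = ℤ.∣ ↥ c ∣
  b = ↧ₙ c

-- The statement is decidable for each N, so it may be proved up to double
-- negation.  The finitely many real numbers involved then have signs, which are
-- recovered from rational approximations with a tolerance ε; for degree 1 each
-- becomes the positivity of a constant plus a sum Σₖ aₖ(xₖ) of unary functions.
--
-- For such sums one passes to a subsequence on which all signs are constant.
-- Only one step is exponential: an Erdős–Rado argument makes the truth of
-- "aₖ is concave on x < y < z" independent of z.  By Dilworth arguments, which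
-- lose a power only, each aₖ then becomes monotone and convex or concave, so that
-- up to a constant it is ± a nonnegative function that at least doubles (or
-- halves) from one point to the next.  Two such functions can be comparable in
-- size only on short sequences; so after further Dilworth steps each is larger
-- than a fixed multiple of the other or vice versa, uniformly in the tuple.  The
-- dominant summand determines the sign of the sum.

module Submission where

open import Defs
open import Data.Bool.Base as Bool using (Bool; true; false; not)
open import Data.Empty using (⊥-elim)
open import Data.Fin.Base as Fin using (Fin; zero; suc; finToFun; funToFin)
open import Data.Fin.Patterns using (0F; 1F; 2F)
open import Data.Fin.Permutation as Perm using (Permutation′; _⟨$⟩ʳ_; _⟨$⟩ˡ_)
import Data.Fin.Properties as Fin
open import Data.Fin.Subset as Subset using (Subset; _∈_; _⊆_; ∣_∣; ⁅_⁆; inside; outside)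
import Data.Fin.Subset.Properties as Subset
open import Data.Integer.Base using (+_)
open import Data.List.Base as List using (List; []; _∷_; length)
open import Data.List.Membership.Propositional using (find; lose) renaming (_∈_ to _∈ₗ_)
import Data.List.Membership.Propositional.Properties as List
import Data.List.Properties as List
open import Data.List.Relation.Unary.All as All using ([]; _∷_)
open import Data.List.Relation.Unary.AllPairs as AllPairs using (AllPairs; []; _∷_)
import Data.List.Relation.Unary.AllPairs.Properties as AllPairs
open import Data.List.Relation.Unary.Any as Any using (Any; here; there)
open import Data.Nat.Base as ℕ using (ℕ; zero; suc; z≤n; s≤s)
open import Data.Nat.Coprimality using (1-coprimeTo)
open import Data.Nat.GeneralisedArithmetic using (fold)
import Data.Nat.Properties as ℕ
open import Data.Product.Base using (∃; ∃₂; _×_; _,_; proj₁; proj₂)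
open import Data.Rational.Base as ℚ using (ℚ; 0ℚ; 1ℚ; ½; mkℚ)
import Data.Rational.Properties as ℚ
open import Data.Rational.Solver using (module +-*-Solver)
open import Data.Sum.Base as Sum using (_⊎_; inj₁; inj₂)
open import Data.Vec.Base as Vec using (Vec; []; _∷_; here; there)
import Data.Vec.Properties as Vec
open import Function.Base using (_∘_; id)
open import Function.Bundles using (_⇔_; mk⇔; Equivalence)
open import Relation.Binary.Definitions using (tri<; tri≈; tri>)
open import Relation.Binary.PropositionalEquality
  using (_≡_; _≢_; refl; sym; trans; cong; cong₂; subst; subst₂; module ≡-Reasoning)
open import Relation.Nullary using (¬_; Dec; yes; no; ¬?; contradiction)
open import Relation.Nullary.Decidable using (⌊_⌋; _×-dec_; decidable-stable; map′)

open import Algebra.Properties.CommutativeMonoid.Sum ℚ.+-0-commutativeMonoid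
  using (sum; sum-cong-≗; sum-permute; ∑-distrib-+)
open +-*-Solver using (solve; con; _:=_; _:+_; _:*_; _:-_; :-_)

-- Homogeneous subsequences

length-filter-¬ : ∀ {A : Set} {P : A → Set} (P? : ∀ x → Dec (P x)) xs →
  length xs ≡ length (List.filter P? xs) ℕ.+ length (List.filter (¬? ∘ P?) xs)
length-filter-¬ P? [] = refl
length-filter-¬ P? (x ∷ xs) with P? x
... | yes _ = cong suc (length-filter-¬ P? xs)
... | no  _ = trans (cong suc (length-filter-¬ P? xs)) (sym (ℕ.+-suc _ _))

head∈ : ∀ {A : Set} {xs : List A} → 1 ℕ.≤ length xs → ∃ (_∈ₗ xs)
head∈ {xs = x ∷ _} _ = x , here refl

length-cartesianProduct : ∀ {A B : Set} (xs : List A) (ys : List B) →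
  length (List.cartesianProduct xs ys) ≡ length xs ℕ.* length ys
length-cartesianProduct []       ys = refl
length-cartesianProduct (x ∷ xs) ys = trans (List.length-++ (List.map (x ,_) ys))
  (cong₂ ℕ._+_ (List.length-map (x ,_) ys) (length-cartesianProduct xs ys))

fold-double : ∀ n s → fold s (2 ℕ.*_) n ≡ 2 ℕ.^ n ℕ.* s
fold-double zero    s = sym (ℕ.*-identityˡ s)
fold-double (suc n) s = trans (cong (2 ℕ.*_) (fold-double n s)) (sym (ℕ.*-assoc 2 (2 ℕ.^ n) s))

module _ {N : ℕ} where

  Sorted : List (Fin N) → Set
  Sorted = AllPairs Fin._<_

  record Subsequence (n : ℕ) (xs : List (Fin N)) : Set where
    constructor subsequence
    field
      elems    : List (Fin N)
      included : ∀ {x} → x ∈ₗ elems → x ∈ₗ xs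
      sorted   : Sorted elems
      long     : n ℕ.≤ length elems

  open Subsequence public

  OnPairs : List (Fin N) → (Fin N → Fin N → Set) → Set
  OnPairs xs P = ∀ {x y} → x ∈ₗ xs → y ∈ₗ xs → x Fin.< y → P x y

  TransitiveOn : List (Fin N) → (Fin N → Fin N → Set) → Set
  TransitiveOn xs P = ∀ {x y z} → x ∈ₗ xs → y ∈ₗ xs → z ∈ₗ xs →
    x Fin.< y → y Fin.< z → P x y → P y z → P x z

  Homogeneous : List (Fin N) → (Fin N → Fin N → Set) → Set
  Homogeneous xs P = OnPairs xs P ⊎ OnPairs xs (λ x y → ¬ P x y)

  filterSub : ∀ {P : Fin N → Set} (P? : ∀ x → Dec (P x)) {xs n} → Sorted xs →
    n ℕ.≤ length (List.filter P? xs) → Subsequence n xs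
  filterSub P? {xs} s l =
    subsequence (List.filter P? xs) (proj₁ ∘ List.∈-filter⁻ P?) (AllPairs.filter⁺ P? s) l

  within : ∀ {n xs ys} → (∀ {x} → x ∈ₗ xs → x ∈ₗ ys) → Subsequence n xs → Subsequence n ys
  within inc S = subsequence (elems S) (inc ∘ included S) (sorted S) (long S)

  prepend : ∀ {n xs y z zs} → y ∈ₗ xs → y Fin.< z → (∀ {x} → x ∈ₗ (z ∷ zs) → x ∈ₗ xs) →
    Sorted (z ∷ zs) → n ℕ.≤ length (z ∷ zs) → Subsequence (suc n) xs
  prepend {y = y} {z} {zs} y∈ y<z inc (z< ∷ s) l = subsequence (y ∷ z ∷ zs)
    (λ { (here refl) → y∈ ; (there m) → inc m })
    ((y<z ∷ All.map (Fin.<-trans y<z) z<) ∷ z< ∷ s) (s≤s l)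

  ChainOrAntichain : (Fin N → Fin N → Set) → ℕ → ℕ → List (Fin N) → Set
  ChainOrAntichain P a b xs =
    (∃ λ (S : Subsequence a xs) → OnPairs (elems S) P) ⊎
    (∃ λ (S : Subsequence b xs) → OnPairs (elems S) (λ x y → ¬ P x y))

  predecessor? : ∀ {P : Fin N → Fin N → Set} (P? : ∀ x y → Dec (P x y)) xs x →
    Dec (Any (λ y → y Fin.< x × P y x) xs)
  predecessor? P? xs x = Any.any? (λ y → y Fin.<? x ×-dec P? y x) xs

  -- The elements with no P-predecessor form an antichain; every other element
  -- extends to the left a chain that starts at it.
  dilworth : ∀ {P : Fin N → Fin N → Set} (P? : ∀ x y → Dec (P x y)) a b xs → Sorted xs →
    TransitiveOn xs P → a ℕ.* b ℕ.≤ length xs →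
    ChainOrAntichain P a b xs
  dilworth P? zero b xs s tr l = inj₁ (subsequence [] (λ ()) [] z≤n , λ ())
  dilworth {P} P? (suc a) b xs s tr l with b ℕ.≤? length (List.filter (¬? ∘ predecessor? P? xs) xs)
  ... | yes b≤ = inj₂ (filterSub _ s b≤ , λ x∈ y∈ x<y pxy →
    proj₂ (List.∈-filter⁻ _ {xs = xs} y∈)
      (lose (proj₁ (List.∈-filter⁻ _ {xs = xs} x∈)) (x<y , pxy)))
  ... | no b≰ = extend (dilworth P? a b R (AllPairs.filter⁺ pred? s)
      (λ x∈ y∈ z∈ → tr (R⊆ x∈) (R⊆ y∈) (R⊆ z∈)) ab≤)
    where
    pred? : ∀ x → Dec (Any (λ y → y Fin.< x × P y x) xs)
    pred? = predecessor? P? xs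
    R M : List (Fin N)
    R = List.filter pred? xs
    M = List.filter (¬? ∘ pred?) xs
    R⊆ : ∀ {x} → x ∈ₗ R → x ∈ₗ xs
    R⊆ = proj₁ ∘ List.∈-filter⁻ pred?
    M<b : length M ℕ.< b
    M<b = ℕ.≰⇒> b≰
    ab≤ : a ℕ.* b ℕ.≤ length R
    ab≤ = ℕ.+-cancelˡ-≤ b _ _ (ℕ.≤-trans l (ℕ.≤-trans
      (ℕ.≤-reflexive (trans (length-filter-¬ pred? xs) (ℕ.+-comm (length R) _)))
      (ℕ.+-monoˡ-≤ (length R) (ℕ.<⇒≤ M<b))))
    extend : ChainOrAntichain P a b R → ChainOrAntichain P (suc a) b xs
    extend (inj₂ (S , h)) = inj₂ (within R⊆ S , h)
    -- An empty chain means `a = 0`, so a single point suffices; one exists because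
    -- `0 < b ≤ length xs`.
    extend (inj₁ (subsequence [] inc so l' , h)) =
      let x , x∈ = head∈ (ℕ.≤-trans (ℕ.≤-trans (s≤s z≤n) M<b)
                     (ℕ.≤-trans (ℕ.m≤m+n b (a ℕ.* b)) l))
      in inj₁ (subsequence (x ∷ []) (λ { (here refl) → x∈ }) ([] ∷ []) (s≤s l') ,
        λ { (here refl) (here refl) x<x → contradiction x<x (Fin.<-irrefl refl) })
    extend (inj₁ (subsequence (z ∷ zs) inc so@(z< ∷ _) l' , h))
      with find (proj₂ (List.∈-filter⁻ pred? {xs = xs} (inc (here refl))))
    ... | y , y∈ , y<z , pyz = inj₁ (prepend y∈ y<z (R⊆ ∘ inc) so l' , chain)
      where
      chain : OnPairs (y ∷ z ∷ zs) P
      chain (here refl) (here refl) x<x = contradiction x<x (Fin.<-irrefl refl)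
      chain (here refl) (there (here refl)) _ = pyz
      chain (here refl) (there (there w∈)) _ =
        tr y∈ (R⊆ (inc (here refl))) (R⊆ (inc (there w∈))) y<z (All.lookup z< w∈)
          pyz (h (here refl) (there w∈) (All.lookup z< w∈))
      chain (there (here refl)) (here refl) z<y =
        contradiction (Fin.<-trans z<y y<z) (Fin.<-irrefl refl)
      chain (there (there w∈)) (here refl) w<y =
        contradiction (Fin.<-trans (All.lookup z< w∈) (Fin.<-trans w<y y<z)) (Fin.<-irrefl refl)
      chain (there v∈) (there w∈) v<w = h v∈ w∈ v<w

  -- Each index is treated on what the previous ones left, and heredity keeps the properties already
  -- won. `b t` points are spent to leave `t`, so the lengths compose as a `fold`.
  refineAll : ∀ {I : Set} (H : I → List (Fin N) → Set) →
    (∀ {i xs ys} → (∀ {x} → x ∈ₗ ys → x ∈ₗ xs) → H i xs → H i ys) →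
    ∀ (b : ℕ → ℕ) is s xs → Sorted xs →
    (∀ {i} → i ∈ₗ is → ∀ t ys → (∀ {x} → x ∈ₗ ys → x ∈ₗ xs) → Sorted ys →
      b t ℕ.≤ length ys → ∃ λ (S : Subsequence t ys) → H i (elems S)) →
    fold s b (length is) ℕ.≤ length xs →
    ∃ λ (S : Subsequence s xs) → ∀ {i} → i ∈ₗ is → H i (elems S)
  refineAll H hered b [] s xs so step l = subsequence xs id so l , λ ()
  refineAll H hered b (i ∷ is) s xs so step l =
    let S , h  = step (here refl) _ xs id so l
        R , h′ = refineAll H hered b is s (elems S) (sorted S)
                   (λ i∈ t ys inc → step (there i∈) t ys (included S ∘ inc)) (long S)
    in within (included S) R , λ { (here refl) → hered (included R) h ; (there i∈) → h′ i∈ }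

  -- `dilworth` with `a = b = t` turns `t * t` points into `t`, and can be run on the relation or on
  -- its negation, whichever is transitive. Each index thus costs one squaring.
  homogenise : ∀ {I : Set} (P : I → Fin N → Fin N → Set) → (∀ i x y → Dec (P i x y)) →
    ∀ is s xs → Sorted xs →
    (∀ {i} → i ∈ₗ is → TransitiveOn xs (P i) ⊎ TransitiveOn xs (λ x y → ¬ P i x y)) →
    fold s (λ t → t ℕ.* t) (length is) ℕ.≤ length xs →
    ∃ λ (S : Subsequence s xs) → ∀ {i} → i ∈ₗ is → Homogeneous (elems S) (P i)
  homogenise {I} P P? is s xs so tr = refineAll (λ i ys → Homogeneous ys (P i)) hered _ is s xs so step
    where
    hered : ∀ {i xs ys} → (∀ {x} → x ∈ₗ ys → x ∈ₗ xs) → Homogeneous xs (P i) → Homogeneous ys (P i)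
    hered inc (inj₁ h) = inj₁ λ x∈ y∈ → h (inc x∈) (inc y∈)
    hered inc (inj₂ h) = inj₂ λ x∈ y∈ → h (inc x∈) (inc y∈)
    step : ∀ {i} → i ∈ₗ is → ∀ t ys → (∀ {x} → x ∈ₗ ys → x ∈ₗ xs) → Sorted ys →
      t ℕ.* t ℕ.≤ length ys → ∃ λ (S : Subsequence t ys) → Homogeneous (elems S) (P i)
    step {i} i∈ t ys inc so l with tr i∈
    ... | inj₁ trans′ with dilworth (P? i) t t ys so
                             (λ x∈ y∈ z∈ → trans′ (inc x∈) (inc y∈) (inc z∈)) l
    ...   | inj₁ (S , h) = S , inj₁ h
    ...   | inj₂ (S , h) = S , inj₂ h
    step {i} i∈ t ys inc so l | inj₂ trans′
      with dilworth (λ x y → ¬? (P? i x y)) t t ys so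
                             (λ x∈ y∈ z∈ → trans′ (inc x∈) (inc y∈) (inc z∈)) l
    ...   | inj₁ (S , h) = S , inj₂ h
    ...   | inj₂ (S , h) = S , inj₁ λ x∈ y∈ x<y → decidable-stable (P? i _ _) (h x∈ y∈ x<y)

  Constant : List (Fin N) → (Fin N → Set) → Set
  Constant xs U = ∀ {x y} → x ∈ₗ xs → y ∈ₗ xs → U x → U y

  -- One of the two classes of `U i` contains at least half of the points.
  constants : ∀ {I : Set} (U : I → Fin N → Set) → (∀ i x → Dec (U i x)) →
    ∀ is s xs → Sorted xs → fold s (2 ℕ.*_) (length is) ℕ.≤ length xs →
    ∃ λ (S : Subsequence s xs) → ∀ {i} → i ∈ₗ is → Constant (elems S) (U i)
  constants U U? is s xs so = refineAll (λ i ys → Constant ys (U i))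
    (λ inc h x∈ y∈ → h (inc x∈) (inc y∈)) _ is s xs so λ {i} _ t ys _ → step i t ys
    where
    step : ∀ i t ys → Sorted ys → 2 ℕ.* t ℕ.≤ length ys →
      ∃ λ (S : Subsequence t ys) → Constant (elems S) (U i)
    step i t ys so l with t ℕ.≤? length (List.filter (U? i) ys)
    ... | yes t≤ = filterSub (U? i) so t≤ , λ _ y∈ _ → proj₂ (List.∈-filter⁻ (U? i) {xs = ys} y∈)
    ... | no t≰ = filterSub (¬? ∘ U? i) so t≤′ ,
      λ x∈ _ u → contradiction u (proj₂ (List.∈-filter⁻ (¬? ∘ U? i) {xs = ys} x∈))
      where
      t≤′ : t ℕ.≤ length (List.filter (¬? ∘ U? i) ys)
      t≤′ = ℕ.+-cancelˡ-≤ t _ _ (ℕ.≤-trans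
        (ℕ.≤-reflexive (cong (t ℕ.+_) (sym (ℕ.+-identityʳ t))))
        (ℕ.≤-trans l (ℕ.≤-trans (ℕ.≤-reflexive (length-filter-¬ (U? i) ys))
          (ℕ.+-monoˡ-≤ _ (ℕ.<⇒≤ (ℕ.≰⇒> t≰))))))

  LastIndependent : List (Fin N) → (Fin N → Fin N → Fin N → Set) → Set
  LastIndependent xs Q = ∀ {x y z w} → x ∈ₗ xs → y ∈ₗ xs → z ∈ₗ xs → w ∈ₗ xs →
    x Fin.< y → y Fin.< z → y Fin.< w → Q x y z → Q x y w

  module _ {I : Set} (Q : I → Fin N → Fin N → Fin N → Set)
    (Q? : ∀ i x y z → Dec (Q i x y z)) (is : List I) where

    -- S holds the points already chosen; they precede those of xs.
    erdosRado-from : ∀ B n S xs → length is ℕ.* (length S ℕ.+ n) ℕ.≤ B → Sorted xs →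
      2 ℕ.^ (suc B ℕ.* n) ℕ.≤ length xs →
      ∃ λ (R : Subsequence n xs) → ∀ {i} → i ∈ₗ is → ∀ {x y z w} →
        x ∈ₗ S ⊎ x ∈ₗ elems R → y ∈ₗ elems R → z ∈ₗ elems R → w ∈ₗ elems R →
        x Fin.< y → y Fin.< z → y Fin.< w → Q i x y z → Q i x y w
    erdosRado-from B zero S xs B≥ so l = subsequence [] (λ ()) [] z≤n , λ _ _ ()
    erdosRado-from B (suc n) S [] B≥ so l =
      contradiction (ℕ.≤-trans (ℕ.m^n>0 2 (suc B ℕ.* suc n)) l) λ ()
    erdosRado-from B (suc n) S (y ∷ xs) B≥ (y< ∷ so) l =
      -- `y` is the next chosen point. The rest is thinned until `Q i x y z` no longer depends on
      -- `z`, for every earlier `x`; pairs with a later second point are settled when that point is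
      -- chosen.
      let T , const = constants (λ (i , x) → Q i x y) (λ (i , x) → Q? i x y)
                        (List.cartesianProduct is S) X xs so (ℕ.≤-trans (ℕ.≤-reflexive c-eq) cX≤)
          R , h = erdosRado-from B n (y ∷ S) (elems T)
                    (subst (λ k → length is ℕ.* k ℕ.≤ B) (ℕ.+-suc (length S) n) B≥)
                    (sorted T) (long T)
          y<R = λ {z} (z∈ : z ∈ₗ elems R) → All.lookup y< (included T (included R z∈))
      in subsequence (y ∷ elems R)
           (λ { (here refl) → here refl ; (there x∈) → there (included T (included R x∈)) })
           (All.tabulate y<R ∷ sorted R) (s≤s (long R)) ,
         λ where
           i∈ (inj₁ x∈) (here refl) (here refl) _ _ y<y _ → contradiction y<y (Fin.<-irrefl refl)
           i∈ (inj₁ x∈) (here refl) _ (here refl) _ _ y<y → contradiction y<y (Fin.<-irrefl refl)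
           i∈ (inj₁ x∈) (here refl) (there z∈) (there w∈) _ _ _ →
             const (List.∈-cartesianProduct⁺ i∈ x∈) (included R z∈) (included R w∈)
           i∈ (inj₂ (here refl)) (here refl) _ _ y<y → contradiction y<y (Fin.<-irrefl refl)
           i∈ (inj₂ (there x∈)) (here refl) _ _ x<y →
             contradiction (Fin.<-trans x<y (y<R x∈)) (Fin.<-irrefl refl)
           i∈ _ (there v∈) (here refl) _ _ v<y →
             contradiction (Fin.<-trans v<y (y<R v∈)) (Fin.<-irrefl refl)
           i∈ _ (there v∈) _ (here refl) _ _ v<y →
             contradiction (Fin.<-trans v<y (y<R v∈)) (Fin.<-irrefl refl)
           i∈ (inj₁ x∈) (there v∈) (there z∈) (there w∈) → h i∈ (inj₁ (there x∈)) v∈ z∈ w∈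
           i∈ (inj₂ (here refl)) (there v∈) (there z∈) (there w∈) →
             h i∈ (inj₁ (here refl)) v∈ z∈ w∈
           i∈ (inj₂ (there x∈)) (there v∈) (there z∈) (there w∈) → h i∈ (inj₂ x∈) v∈ z∈ w∈
      where
      X c : ℕ
      X = 2 ℕ.^ (suc B ℕ.* n)
      c = length (List.cartesianProduct is S)
      c-eq : fold X (2 ℕ.*_) c ≡ 2 ℕ.^ c ℕ.* X
      c-eq = fold-double c X
      c≤B : c ℕ.≤ B
      c≤B = ℕ.≤-trans (ℕ.≤-reflexive (length-cartesianProduct is S))
        (ℕ.≤-trans (ℕ.*-monoʳ-≤ (length is) (ℕ.m≤m+n (length S) (suc n))) B≥)
      open ℕ.≤-Reasoning
      -- The list is halved `c ≤ B` times; one further factor 2 pays for `y` itself.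
      cX≤ : 2 ℕ.^ c ℕ.* X ℕ.≤ length xs
      cX≤ = ℕ.≤-pred (begin
        suc (2 ℕ.^ c ℕ.* X)
          ≤⟨ s≤s (ℕ.*-monoˡ-≤ X (ℕ.^-monoʳ-≤ 2 c≤B)) ⟩
        suc (2 ℕ.^ B ℕ.* X)
          ≤⟨ ℕ.+-monoˡ-≤ _ (ℕ.*-mono-≤ (ℕ.m^n>0 2 B) (ℕ.m^n>0 2 (suc B ℕ.* n))) ⟩
        2 ℕ.^ B ℕ.* X ℕ.+ 2 ℕ.^ B ℕ.* X
          ≡⟨ trans (cong (2 ℕ.^ B ℕ.* X ℕ.+_) (sym (ℕ.+-identityʳ _))) (sym (ℕ.*-assoc 2 (2 ℕ.^ B) X)) ⟩
        2 ℕ.^ suc B ℕ.* X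
          ≡⟨ ℕ.^-distribˡ-+-* 2 (suc B) (suc B ℕ.* n) ⟨
        2 ℕ.^ (suc B ℕ.+ suc B ℕ.* n)
          ≡⟨ cong (2 ℕ.^_) (ℕ.*-suc (suc B) n) ⟨
        2 ℕ.^ (suc B ℕ.* suc n)
          ≤⟨ l ⟩
        suc (length xs) ∎)

    -- `length is * n` bounds the number of halvings at any one of the `n` stages, which makes the
    -- exponent quadratic in `n`.
    erdosRado : ∀ n xs → Sorted xs →
      2 ℕ.^ (suc (length is ℕ.* n) ℕ.* n) ℕ.≤ length xs →
      ∃ λ (R : Subsequence n xs) → ∀ {i} → i ∈ₗ is → LastIndependent (elems R) (Q i)
    erdosRado n xs so l =
      let R , h = erdosRado-from (length is ℕ.* n) n [] xs ℕ.≤-refl so l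
      in R , λ i∈ x∈ → h i∈ (inj₂ x∈)

-- Sums with a dominant summand

-- Linear arithmetic is reduced to identities for the ring solver: b ≥ a and
-- d ≥ c are equivalent when the differences of their sides agree.
rearrange-≤ : ∀ {a b c d} → a ℚ.≤ b → b ℚ.- a ≡ d ℚ.- c → c ℚ.≤ d
rearrange-≤ {a} {b} {c} {d} a≤b eq = subst₂ ℚ._≤_
  (solve 2 (λ a c → a :+ (c :- a) := c) refl a c)
  (trans (solve 3 (λ a b c → b :+ (c :- a) := (b :- a) :+ c) refl a b c)
    (trans (cong (ℚ._+ c) eq) (solve 2 (λ c d → (d :- c) :+ c := d) refl c d)))
  (ℚ.+-monoˡ-≤ (c ℚ.- a) a≤b)

rearrange-< : ∀ {a b c d} → a ℚ.< b → b ℚ.- a ≡ d ℚ.- c → c ℚ.< d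
rearrange-< {a} {b} {c} {d} a<b eq = subst₂ ℚ._<_
  (solve 2 (λ a c → a :+ (c :- a) := c) refl a c)
  (trans (solve 3 (λ a b c → b :+ (c :- a) := (b :- a) :+ c) refl a b c)
    (trans (cong (ℚ._+ c) eq) (solve 2 (λ c d → (d :- c) :+ c := d) refl c d)))
  (ℚ.+-monoˡ-< (c ℚ.- a) a<b)

≰⇒≥ : ∀ {p q} → ¬ p ℚ.≤ q → q ℚ.≤ p
≰⇒≥ = ℚ.<⇒≤ ∘ ℚ.≰⇒>

neg-cancel-≤ : ∀ {p q} → ℚ.- p ℚ.≤ ℚ.- q → q ℚ.≤ p
neg-cancel-≤ {p} {q} -p≤-q = rearrange-≤ -p≤-q (solve 2 (λ p q → :- q :- :- p := p :- q) refl p q)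

fromℕ : ℕ → ℚ
fromℕ zero    = 0ℚ
fromℕ (suc n) = 1ℚ ℚ.+ fromℕ n

0≤1 : 0ℚ ℚ.≤ 1ℚ
0≤1 = ℚ.nonNegative⁻¹ 1ℚ

fromℕ-nonneg : ∀ n → 0ℚ ℚ.≤ fromℕ n
fromℕ-nonneg zero    = ℚ.≤-refl
fromℕ-nonneg (suc n) = ℚ.+-mono-≤ 0≤1 (fromℕ-nonneg n)

fromℕ-mono : ∀ {m n} → m ℕ.≤ n → fromℕ m ℚ.≤ fromℕ n
fromℕ-mono {n = n} z≤n = fromℕ-nonneg n
fromℕ-mono (s≤s m≤n)   = ℚ.+-monoʳ-≤ 1ℚ (fromℕ-mono m≤n)

fromℕ-+ : ∀ m n → fromℕ (m ℕ.+ n) ≡ fromℕ m ℚ.+ fromℕ n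
fromℕ-+ zero    n = sym (ℚ.+-identityˡ (fromℕ n))
fromℕ-+ (suc m) n = trans (cong (1ℚ ℚ.+_) (fromℕ-+ m n)) (sym (ℚ.+-assoc 1ℚ (fromℕ m) (fromℕ n)))

fromℕ-* : ∀ m n → fromℕ (m ℕ.* n) ≡ fromℕ m ℚ.* fromℕ n
fromℕ-* zero    n = sym (ℚ.*-zeroˡ (fromℕ n))
fromℕ-* (suc m) n = trans (fromℕ-+ n (m ℕ.* n)) (trans (cong (fromℕ n ℚ.+_) (fromℕ-* m n))
  (solve 2 (λ m n → n :+ m :* n := (con 1ℚ :+ m) :* n) refl (fromℕ m) (fromℕ n)))

*-monoˡ-≤ : ∀ {c p q} → 0ℚ ℚ.≤ c → p ℚ.≤ q → c ℚ.* p ℚ.≤ c ℚ.* q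
*-monoˡ-≤ {c} 0≤c = ℚ.*-monoˡ-≤-nonNeg c {{ℚ.nonNegative 0≤c}}

square≤ : ∀ m {n q} → m ℕ.* m ℕ.≤ n → 0ℚ ℚ.≤ q →
  fromℕ m ℚ.* (fromℕ m ℚ.* q) ℚ.≤ fromℕ n ℚ.* q
square≤ m {n} {q} mm≤n 0≤q = ℚ.≤-trans
  (ℚ.≤-reflexive (trans (sym (ℚ.*-assoc (fromℕ m) (fromℕ m) q)) (cong (ℚ._* q) (sym (fromℕ-* m m)))))
  (ℚ.*-monoʳ-≤-nonNeg q {{ℚ.nonNegative 0≤q}} (fromℕ-mono mm≤n))

*-monoʳ-≤ : ∀ {c p q} → 0ℚ ℚ.≤ c → p ℚ.≤ q → p ℚ.* c ℚ.≤ q ℚ.* c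
*-monoʳ-≤ {c} 0≤c = ℚ.*-monoʳ-≤-nonNeg c {{ℚ.nonNegative 0≤c}}

signed : Bool → ℚ → ℚ
signed true  q = q
signed false q = ℚ.- q

signed-not : ∀ b q → signed (not b) q ≡ ℚ.- signed b q
signed-not true  q = refl
signed-not false q = solve 1 (λ q → q := :- (:- q)) refl q

signed-lower : ∀ b {q c} → 0ℚ ℚ.≤ q → q ℚ.≤ c → ℚ.- c ℚ.≤ signed b q
signed-lower true  0≤q q≤c = ℚ.≤-trans (ℚ.neg-antimono-≤ (ℚ.≤-trans 0≤q q≤c)) 0≤q
signed-lower false 0≤q q≤c = ℚ.neg-antimono-≤ q≤c

signed-zero : ∀ b → signed b 0ℚ ≡ 0ℚ
signed-zero true  = refl
signed-zero false = refl

*-signed : ∀ c b q → c ℚ.* signed b q ≡ signed b (c ℚ.* q)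
*-signed c true  q = refl
*-signed c false q = sym (ℚ.neg-distribʳ-* c q)

sum-* : ∀ {n} c (f : Fin n → ℚ) → c ℚ.* sum f ≡ sum (λ i → c ℚ.* f i)
sum-* {zero}  c f = ℚ.*-zeroʳ c
sum-* {suc n} c f = trans (ℚ.*-distribˡ-+ c (f zero) (sum (f ∘ suc)))
  (cong (c ℚ.* f zero ℚ.+_) (sum-* c (f ∘ suc)))

sum-neg : ∀ {n} (f : Fin n → ℚ) → sum (λ i → ℚ.- f i) ≡ ℚ.- sum f
sum-neg {zero}  f = refl
sum-neg {suc n} f = trans (cong (ℚ.- f zero ℚ.+_) (sum-neg (f ∘ suc)))
  (sym (ℚ.neg-distrib-+ (f zero) (sum (f ∘ suc))))

sum-zero : ∀ {n} (f : Fin n → ℚ) → (∀ i → f i ≡ 0ℚ) → sum f ≡ 0ℚ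
sum-zero {zero}  f z = refl
sum-zero {suc n} f z = cong₂ ℚ._+_ (z zero) (sum-zero (f ∘ suc) (z ∘ suc))

sum-lower : ∀ {n} (f : Fin n → ℚ) {c} → (∀ i → ℚ.- c ℚ.≤ f i) →
  ℚ.- (fromℕ n ℚ.* c) ℚ.≤ sum f
sum-lower {zero}  f {c} l = ℚ.≤-reflexive (cong ℚ.-_ (ℚ.*-zeroˡ c))
sum-lower {suc n} f {c} l = ℚ.≤-trans
  (ℚ.≤-reflexive (solve 2 (λ n c → :- ((con 1ℚ :+ n) :* c) := :- c :+ :- (n :* c)) refl (fromℕ n) c))
  (ℚ.+-mono-≤ (l zero) (sum-lower (f ∘ suc) (l ∘ suc)))

sum-lower-at : ∀ {n} (f : Fin n → ℚ) {c} k → 0ℚ ℚ.≤ c → (∀ i → i ≢ k → ℚ.- c ℚ.≤ f i) →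
  f k ℚ.- fromℕ n ℚ.* c ℚ.≤ sum f
sum-lower-at {suc n} f {c} zero 0≤c l = ℚ.+-monoʳ-≤ (f zero) (ℚ.≤-trans
  (ℚ.neg-antimono-≤ (*-monoʳ-≤ 0≤c (fromℕ-mono (ℕ.n≤1+n n))))
  (sum-lower (f ∘ suc) λ i → l (suc i) λ ()))
sum-lower-at {suc n} f {c} (suc k) 0≤c l = ℚ.≤-trans
  (ℚ.≤-reflexive (solve 3 (λ f n c → f :- (con 1ℚ :+ n) :* c := :- c :+ (f :- n :* c)) refl
    (f (suc k)) (fromℕ n) c))
  (ℚ.+-mono-≤ (l zero λ ()) (sum-lower-at (f ∘ suc) k 0≤c λ i i≢k → l (suc i) (i≢k ∘ Fin.suc-injective)))

argmax : ∀ {n} (v : Fin (suc n) → ℚ) → ∃ λ k → ∀ i → v i ℚ.≤ v k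
argmax {zero}  v = zero , λ { zero → ℚ.≤-refl }
argmax {suc n} v with argmax (v ∘ suc)
... | k , max with ℚ.≤-total (v zero) (v (suc k))
...   | inj₁ 0≤k = suc k , λ { zero → 0≤k ; (suc i) → max i }
...   | inj₂ k≤0 = zero , λ { zero → ℚ.≤-refl ; (suc i) → ℚ.≤-trans (max i) k≤0 }

module _ {n : ℕ} where

  private
    T : ℚ
    T = fromℕ (suc n)
    0≤T : 0ℚ ℚ.≤ T
    0≤T = fromℕ-nonneg (suc n)

  -- After scaling by `T = n + 1`, the `k`-th summand is `T * v k` and every other one is at least
  -- `- v k`, so at least one `v k` remains.
  dominant-pos : ∀ (s : Fin n → Bool) (v : Fin n → ℚ) k → (∀ i → 0ℚ ℚ.≤ v i) → 0ℚ ℚ.< v k →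
    (∀ i → i ≢ k → T ℚ.* v i ℚ.≤ v k) → s k ≡ true → 0ℚ ℚ.< sum (λ i → signed (s i) (v i))
  dominant-pos s v k 0≤v 0<vk dom sk = ℚ.*-cancelˡ-<-nonNeg T {{ℚ.nonNegative 0≤T}}
    (ℚ.<-≤-trans (subst₂ ℚ._<_ (sym (ℚ.*-zeroʳ T)) eq 0<vk)
      (ℚ.≤-trans (sum-lower-at (λ i → T ℚ.* signed (s i) (v i)) k (0≤v k)
         λ i i≢k → subst (ℚ.- v k ℚ.≤_) (sym (*-signed T (s i) (v i)))
           (signed-lower (s i)
             (subst (ℚ._≤ T ℚ.* v i) (ℚ.*-zeroʳ T) (*-monoˡ-≤ 0≤T (0≤v i))) (dom i i≢k)))
       (ℚ.≤-reflexive (sym (sum-* T (λ i → signed (s i) (v i)))))))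
    where
    eq : v k ≡ T ℚ.* signed (s k) (v k) ℚ.- fromℕ n ℚ.* v k
    eq rewrite sk = solve 2 (λ n v → v := (con 1ℚ :+ n) :* v :- n :* v) refl (fromℕ n) (v k)

  -- If `s k` were `false`, flipping all signs would give `k` a positive sign, and the negated sum
  -- would be positive as well.
  dominant-sign : ∀ (s : Fin n → Bool) (v : Fin n → ℚ) k → (∀ i → 0ℚ ℚ.≤ v i) → 0ℚ ℚ.< v k →
    (∀ i → i ≢ k → T ℚ.* v i ℚ.≤ v k) → 0ℚ ℚ.< sum (λ i → signed (s i) (v i)) → s k ≡ true
  dominant-sign s v k 0≤v 0<vk dom 0<Σ with s k in sk
  ... | true  = refl
  ... | false = contradiction
    (subst (0ℚ ℚ.<_) (trans (sum-cong-≗ λ i → signed-not (s i) (v i)) (sum-neg λ i → signed (s i) (v i)))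
      (dominant-pos (not ∘ s) v k 0≤v 0<vk dom (cong not sk)))
    (ℚ.<-asym (ℚ.neg-antimono-< 0<Σ))

-- Let `v k` be the largest value. If it is positive, each comparison with another index must go in
-- favour of `k`, and then does so for `w` too. The sign at `k` decides both sums.
sign-determined : ∀ {n} (s : Fin n → Bool) (v w : Fin n → ℚ) →
  (∀ i → 0ℚ ℚ.≤ v i) → (∀ i → 0ℚ ℚ.≤ w i) → (∀ i → 0ℚ ℚ.< v i → 0ℚ ℚ.< w i) →
  (let T = fromℕ (suc n) in ∀ i j → i ≢ j →
    (T ℚ.* v i ℚ.≤ v j × T ℚ.* w i ℚ.≤ w j) ⊎ (T ℚ.* v j ℚ.≤ v i × T ℚ.* w j ℚ.≤ w i)) →
  0ℚ ℚ.< sum (λ i → signed (s i) (v i)) → 0ℚ ℚ.< sum (λ i → signed (s i) (w i))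
sign-determined {zero}  s v w 0≤v 0≤w v⇒w cmp 0<0 = contradiction 0<0 (ℚ.<-irrefl refl)
sign-determined {suc n} s v w 0≤v 0≤w v⇒w cmp 0<Σ with argmax v
... | k , max with ℚ._<?_ 0ℚ (v k)
... | no vk≤0 = contradiction 0<Σ (ℚ.<-irrefl (sym (sum-zero _ λ i →
  trans (cong (signed (s i)) (ℚ.≤-antisym (ℚ.≤-trans (max i) (ℚ.≮⇒≥ vk≤0)) (0≤v i)))
    (signed-zero (s i)))))
... | yes 0<vk = dominant-pos s w k 0≤w (v⇒w k 0<vk) (λ i → proj₂ ∘ dom i)
        (dominant-sign s v k 0≤v 0<vk (λ i → proj₁ ∘ dom i) 0<Σ)
  where
  T : ℚ
  T = fromℕ (2 ℕ.+ n)
  dom : ∀ i → i ≢ k → T ℚ.* v i ℚ.≤ v k × T ℚ.* w i ℚ.≤ w k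
  dom i i≢k with cmp i k i≢k
  ... | inj₁ h = h
  -- `T ≥ 2` here, so `T * v k ≤ v i ≤ v k` is impossible for positive `v k`.
  ... | inj₂ (Tvk≤vi , _) = contradiction (ℚ.<-≤-trans 0<vk
    (rearrange-≤ (ℚ.≤-trans (ℚ.+-monoʳ-≤ (v k) 0≤nv) (ℚ.≤-trans Tvk≤vi′ (max i)))
      (solve 1 (λ v → v :- (v :+ v) := con 0ℚ :- v) refl (v k))))
    (ℚ.<-irrefl refl)
    where
    Tvk≤vi′ : v k ℚ.+ fromℕ (suc n) ℚ.* v k ℚ.≤ v i
    Tvk≤vi′ = ℚ.≤-trans (ℚ.≤-reflexive
      (solve 2 (λ n v → v :+ n :* v := (con 1ℚ :+ n) :* v) refl (fromℕ (suc n)) (v k))) Tvk≤vi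
    0≤nv : v k ℚ.≤ fromℕ (suc n) ℚ.* v k
    0≤nv = ℚ.≤-trans (ℚ.≤-reflexive (solve 1 (λ v → v := (con 1ℚ :+ con 0ℚ) :* v) refl (v k)))
      (*-monoʳ-≤ (0≤v k) (fromℕ-mono {1} {suc n} (s≤s z≤n)))

-- Growth of doubling sequences

module _ {N : ℕ} where

  Doubling : List (Fin N) → (Fin N → ℚ) → Set
  Doubling xs h = OnPairs xs (λ x y → h x ℚ.+ h x ℚ.≤ h y) ⊎ OnPairs xs (λ x y → h y ℚ.+ h y ℚ.≤ h x)

  -- Doubling forces exponential growth; the linear bound kept here is all that `spread` uses.
  growth : ∀ {h : Fin N → ℚ} x xs → Sorted (x ∷ xs) → (∀ {y} → y ∈ₗ (x ∷ xs) → 0ℚ ℚ.≤ h y) →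
    OnPairs (x ∷ xs) (λ x y → h x ℚ.+ h x ℚ.≤ h y) →
    ∃ λ z → z ∈ₗ (x ∷ xs) × fromℕ (suc (length xs)) ℚ.* h x ℚ.≤ h z
  growth {h} x [] so 0≤h d = x , here refl ,
    ℚ.≤-reflexive (solve 1 (λ v → (con 1ℚ :+ con 0ℚ) :* v := v) refl (h x))
  growth {h} x (y ∷ ys) ((x<y ∷ _) ∷ so) 0≤h d
    with growth y ys so (0≤h ∘ there) (λ u∈ v∈ → d (there u∈) (there v∈))
  ... | z , z∈ , le = z , there z∈ , (begin
    (1ℚ ℚ.+ k) ℚ.* h x        ≤⟨ *-monoʳ-≤ (0≤h (here refl)) (ℚ.+-monoˡ-≤ k 1≤k) ⟩
    (k ℚ.+ k) ℚ.* h x         ≡⟨ solve 2 (λ k v → (k :+ k) :* v := k :* (v :+ v)) refl k (h x) ⟩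
    k ℚ.* (h x ℚ.+ h x)       ≤⟨ *-monoˡ-≤ (fromℕ-nonneg (suc (length ys))) (d (here refl) (there (here refl)) x<y) ⟩
    k ℚ.* h y                 ≤⟨ le ⟩
    h z                       ∎)
    where
    open ℚ.≤-Reasoning
    k : ℚ
    k = fromℕ (suc (length ys))
    1≤k : 1ℚ ℚ.≤ k
    1≤k = fromℕ-mono {1} {suc (length ys)} (s≤s z≤n)

  decay : ∀ {h : Fin N → ℚ} x xs → Sorted (x ∷ xs) → (∀ {y} → y ∈ₗ (x ∷ xs) → 0ℚ ℚ.≤ h y) →
    OnPairs (x ∷ xs) (λ x y → h y ℚ.+ h y ℚ.≤ h x) →
    ∃ λ z → z ∈ₗ (x ∷ xs) × fromℕ (suc (length xs)) ℚ.* h z ℚ.≤ h x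
  decay {h} x [] so 0≤h d = x , here refl ,
    ℚ.≤-reflexive (solve 1 (λ v → (con 1ℚ :+ con 0ℚ) :* v := v) refl (h x))
  decay {h} x (y ∷ ys) ((x<y ∷ _) ∷ so) 0≤h d
    with decay y ys so (0≤h ∘ there) (λ u∈ v∈ → d (there u∈) (there v∈))
  ... | z , z∈ , le = z , there z∈ , (begin
    (1ℚ ℚ.+ k) ℚ.* h z        ≤⟨ *-monoʳ-≤ (0≤h (there z∈)) (ℚ.+-monoˡ-≤ k 1≤k) ⟩
    (k ℚ.+ k) ℚ.* h z         ≡⟨ solve 2 (λ k v → (k :+ k) :* v := k :* v :+ k :* v) refl k (h z) ⟩
    k ℚ.* h z ℚ.+ k ℚ.* h z   ≤⟨ ℚ.+-mono-≤ le le ⟩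
    h y ℚ.+ h y               ≤⟨ d (here refl) (there (here refl)) x<y ⟩
    h x                       ∎)
    where
    open ℚ.≤-Reasoning
    k : ℚ
    k = fromℕ (suc (length ys))
    1≤k : 1ℚ ℚ.≤ k
    1≤k = fromℕ-mono {1} {suc (length ys)} (s≤s z≤n)

  -- The ratio `n * n` is written as two nested factors because it will be set against two
  -- successive comparisons, each by the factor `n`.
  spread : ∀ {h : Fin N → ℚ} n xs → Sorted xs → (∀ {y} → y ∈ₗ xs → 0ℚ ℚ.≤ h y) → Doubling xs h →
    1 ℕ.≤ length xs → n ℕ.* n ℕ.≤ length xs →
    ∃₂ λ y z → y ∈ₗ xs × z ∈ₗ xs × fromℕ n ℚ.* (fromℕ n ℚ.* h y) ℚ.≤ h z
  spread {h} n (x ∷ xs) so 0≤h (inj₁ d) _ l =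
    let z , z∈ , le = growth x xs so 0≤h d
    in x , z , here refl , z∈ , ℚ.≤-trans (square≤ n l (0≤h (here refl))) le
  spread {h} n (x ∷ xs) so 0≤h (inj₂ d) _ l =
    let z , z∈ , le = decay x xs so 0≤h d
    in z , x , z∈ , here refl , ℚ.≤-trans (square≤ n l (0≤h z∈)) le

-- Sums of unary functions along a sequence

square : ℕ → ℕ
square t = t ℕ.* t

module _ {N : ℕ} where

  splitLast : ∀ n (xs : List (Fin N)) → Sorted xs → suc n ℕ.≤ length xs →
    ∃ λ w → w ∈ₗ xs × ∃ λ (S : Subsequence n xs) → ∀ {x} → x ∈ₗ elems S → x Fin.< w
  splitLast n (x ∷ []) so (s≤s l) = x , here refl , subsequence [] (λ ()) [] l , λ ()
  splitLast zero (x ∷ y ∷ ys) so l = x , here refl , subsequence [] (λ ()) [] z≤n , λ ()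
  splitLast (suc n) (x ∷ y ∷ ys) (x< ∷ so) (s≤s l) =
    let w , w∈ , S , <w = splitLast n (y ∷ ys) so l
    in w , there w∈ ,
       subsequence (x ∷ elems S) (λ { (here refl) → here refl ; (there z∈) → there (included S z∈) })
         (All.tabulate (All.lookup x< ∘ included S) ∷ sorted S) (s≤s (long S)) ,
       λ { (here refl) → All.lookup x< w∈ ; (there z∈) → <w z∈ }

  Monotone : List (Fin N) → (Fin N → ℚ) → Set
  Monotone xs v = OnPairs xs (λ x y → v x ℚ.≤ v y) ⊎ OnPairs xs (λ x y → v y ℚ.≤ v x)

  -- If `v` increases, `u x ≤ v y` survives every move of `y` to the right; if `v` decreases, its
  -- failure does. Hence comparisons of an arbitrary `u` with a monotone `v` are open to `dilworth`.
  threshold-transitive : ∀ {xs} (u v : Fin N → ℚ) → Monotone xs v →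
    TransitiveOn xs (λ x y → u x ℚ.≤ v y) ⊎ TransitiveOn xs (λ x y → ¬ u x ℚ.≤ v y)
  threshold-transitive u v (inj₁ m) = inj₁ λ x∈ y∈ z∈ x<y y<z xy yz → ℚ.≤-trans xy (m y∈ z∈ y<z)
  threshold-transitive u v (inj₂ m) = inj₂ λ x∈ y∈ z∈ x<y y<z ¬xy ¬yz xz →
    ¬xy (ℚ.≤-trans xz (m y∈ z∈ y<z))

  monotone-map : ∀ {xs v} (φ : ℚ → ℚ) → (∀ {p q} → p ℚ.≤ q → φ p ℚ.≤ φ q) →
    Monotone xs v → Monotone xs (φ ∘ v)
  monotone-map φ mono (inj₁ m) = inj₁ λ x∈ y∈ x<y → mono (m x∈ y∈ x<y)
  monotone-map φ mono (inj₂ m) = inj₂ λ x∈ y∈ x<y → mono (m x∈ y∈ x<y)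

  monotone-neg : ∀ {xs v} → Monotone xs v → Monotone xs (ℚ.-_ ∘ v)
  monotone-neg (inj₁ m) = inj₂ λ x∈ y∈ x<y → ℚ.neg-antimono-≤ (m x∈ y∈ x<y)
  monotone-neg (inj₂ m) = inj₁ λ x∈ y∈ x<y → ℚ.neg-antimono-≤ (m x∈ y∈ x<y)

  -- The increment from `x` to `y` is at least that from `y` to `z`, however the indices are spaced.
  -- Imposed on triples with one end fixed, this is a doubling condition on the distance of `f` from
  -- its value at that end.
  Concave : (Fin N → ℚ) → Fin N → Fin N → Fin N → Set
  Concave f x y z = f x ℚ.+ f z ℚ.≤ f y ℚ.+ f y

  record NormalForm (xs : List (Fin N)) (f : Fin N → ℚ) : Set where
    field
      const    : ℚ
      sign     : Bool
      size     : Fin N → ℚ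
      split    : ∀ x → f x ≡ const ℚ.+ signed sign (size x)
      nonneg   : ∀ {x} → x ∈ₗ xs → 0ℚ ℚ.≤ size x
      doubling : Doubling xs size

  open NormalForm public

  doubling⇒monotone : ∀ {xs h} → (∀ {x} → x ∈ₗ xs → 0ℚ ℚ.≤ h x) → Doubling xs h → Monotone xs h
  doubling⇒monotone {h = h} 0≤h (inj₁ d) = inj₁ λ {x} {y} x∈ y∈ x<y →
    ℚ.≤-trans (subst (ℚ._≤ h x ℚ.+ h x) (ℚ.+-identityʳ (h x)) (ℚ.+-monoʳ-≤ (h x) (0≤h x∈))) (d x∈ y∈ x<y)
  doubling⇒monotone {h = h} 0≤h (inj₂ d) = inj₂ λ {x} {y} x∈ y∈ x<y →
    ℚ.≤-trans (subst (ℚ._≤ h y ℚ.+ h y) (ℚ.+-identityʳ (h y)) (ℚ.+-monoʳ-≤ (h y) (0≤h y∈))) (d x∈ y∈ x<y)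

  -- A convex increasing sequence is measured from its first point b, a concave
  -- increasing one from its last point w, and symmetrically for decreasing ones.
  normalise : ∀ {f : Fin N → ℚ} {ys us b w} →
    (∀ {x} → x ∈ₗ us → x ∈ₗ ys) → b ∈ₗ ys → w ∈ₗ ys →
    (∀ {x} → x ∈ₗ us → b Fin.< x) → (∀ {x} → x ∈ₗ us → x Fin.< w) →
    Homogeneous ys (λ x y → f x ℚ.≤ f y) → LastIndependent ys (Concave f) →
    Homogeneous (b ∷ us) (λ x y → Concave f x y w) → NormalForm us f
  normalise {f} {ys} {us} {b} {w} us⊆ b∈ w∈ b< <w = go
    where
    0≤- : ∀ {p q} → p ℚ.≤ q → 0ℚ ℚ.≤ q ℚ.- p
    0≤- {p} {q} p≤q = rearrange-≤ p≤q (solve 2 (λ p q → q :- p := (q :- p) :- con 0ℚ) refl p q)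

    go : Homogeneous ys (λ x y → f x ℚ.≤ f y) → LastIndependent ys (Concave f) →
      Homogeneous (b ∷ us) (λ x y → Concave f x y w) → NormalForm us f
    go (inj₁ incr) indep (inj₁ conc) = record
      { const = f w ; sign = false ; size = λ x → f w ℚ.- f x
      ; split = λ x → solve 2 (λ w x → x := w :+ :- (w :- x)) refl (f w) (f x)
      ; nonneg = λ x∈ → 0≤- (incr (us⊆ x∈) w∈ (<w x∈))
      ; doubling = inj₂ λ {x} {y} x∈ y∈ x<y → rearrange-≤ (conc (there x∈) (there y∈) x<y)
          (solve 3 (λ x y w → (y :+ y) :- (x :+ w) := (w :- x) :- ((w :- y) :+ (w :- y))) refl
            (f x) (f y) (f w)) }
    go (inj₁ incr) indep (inj₂ conv) = record
      { const = f b ; sign = true ; size = λ x → f x ℚ.- f b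
      ; split = λ x → solve 2 (λ b x → x := b :+ (x :- b)) refl (f b) (f x)
      ; nonneg = λ x∈ → 0≤- (incr b∈ (us⊆ x∈) (b< x∈))
      ; doubling = inj₁ λ {x} {y} x∈ y∈ x<y → rearrange-≤
          -- Convexity is known with third point `w`; last-independence moves the third point to
          -- `y`.
          (≰⇒≥ (conv (here refl) (there x∈) (b< x∈) ∘
            indep b∈ (us⊆ x∈) (us⊆ y∈) w∈ (b< x∈) x<y (<w x∈)))
          (solve 3 (λ x y b → (b :+ y) :- (x :+ x) := (y :- b) :- ((x :- b) :+ (x :- b))) refl
            (f x) (f y) (f b)) }
    go (inj₂ decr) indep (inj₁ conc) = record
      { const = f b ; sign = false ; size = λ x → f b ℚ.- f x
      ; split = λ x → solve 2 (λ b x → x := b :+ :- (b :- x)) refl (f b) (f x)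
      ; nonneg = λ x∈ → 0≤- (≰⇒≥ (decr b∈ (us⊆ x∈) (b< x∈)))
      ; doubling = inj₁ λ {x} {y} x∈ y∈ x<y → rearrange-≤
          (indep b∈ (us⊆ x∈) w∈ (us⊆ y∈) (b< x∈) (<w x∈) x<y (conc (here refl) (there x∈) (b< x∈)))
          (solve 3 (λ x y b → (x :+ x) :- (b :+ y) := (b :- y) :- ((b :- x) :+ (b :- x))) refl
            (f x) (f y) (f b)) }
    go (inj₂ decr) indep (inj₂ conv) = record
      { const = f w ; sign = true ; size = λ x → f x ℚ.- f w
      ; split = λ x → solve 2 (λ w x → x := w :+ (x :- w)) refl (f w) (f x)
      ; nonneg = λ x∈ → 0≤- (≰⇒≥ (decr (us⊆ x∈) w∈ (<w x∈)))
      ; doubling = inj₂ λ {x} {y} x∈ y∈ x<y → rearrange-≤ (≰⇒≥ (conv (there x∈) (there y∈) x<y))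
          (solve 3 (λ x y w → (x :+ w) :- (y :+ y) := (x :- w) :- ((y :- w) :+ (y :- w))) refl
            (f x) (f y) (f w)) }

-- A common subsequence on which finitely many sums keep their sign

module _ {J : Set} (js : List J) (complete : ∀ j → j ∈ₗ js) (r : ℕ) where

  functions : List (J × Fin r)
  functions = List.cartesianProduct js (List.allFin r)

  comparisons : List (J × Fin (suc r) × Fin (suc r) × Fin 3)
  comparisons = List.cartesianProduct js (List.cartesianProduct (List.allFin (suc r))
    (List.cartesianProduct (List.allFin (suc r)) (List.allFin 3)))

  ∈-functions : ∀ i → i ∈ₗ functions
  ∈-functions (j , k) = List.∈-cartesianProduct⁺ (complete j) (List.∈-allFin k)

  ∈-comparisons : ∀ i → i ∈ₗ comparisons
  ∈-comparisons (j , k , l , o) = List.∈-cartesianProduct⁺ (complete j)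
    (List.∈-cartesianProduct⁺ (List.∈-allFin k)
      (List.∈-cartesianProduct⁺ (List.∈-allFin l) (List.∈-allFin o)))

  -- Lengths needed before each refinement, computed backwards from the final `s`. Each outer `suc`
  -- pays for a reference point that is set aside: `x₀`, `b` and `w` respectively. `square (2 + r)`
  -- leaves room for `spread` even when `s` is small.
  size₃ size₂ size₁ exponent : ℕ → ℕ
  size₃ s = fold (suc (s ℕ.+ square (2 ℕ.+ r))) square (length comparisons)
  size₂ s = fold (suc (size₃ s)) square (length functions)
  size₁ s = fold (suc (size₂ s)) square (length functions)
  exponent s = suc (length functions ℕ.* size₁ s) ℕ.* size₁ s

  module _ {N : ℕ} (a : J → Fin r → Fin N → ℚ) (c : J → ℚ) where

    SameSign : List (Fin N) → Set
    SameSign xs = ∀ j (x y : Fin r → Fin N) → Increasing x → Increasing y →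
      (∀ k → x k ∈ₗ xs) → (∀ k → y k ∈ₗ xs) →
      0ℚ ℚ.< c j ℚ.+ sum (λ k → a j k (x k)) → 0ℚ ℚ.< c j ℚ.+ sum (λ k → a j k (y k))

    -- The points `w` and `b` are cut off the two ends so that one pair of reference points serves
    -- all functions at once.
    normal-sequences : ∀ s xs → Sorted xs → 2 ℕ.^ exponent s ℕ.≤ length xs →
      ∃ λ (S : Subsequence (size₃ s) xs) → ∀ j k → NormalForm (elems S) (a j k)
    normal-sequences s xs so l
      with erdosRado (λ (j , k) → Concave (a j k)) (λ _ _ _ _ → _ ℚ.≤? _) functions
             (size₁ s) xs so l
    ... | R₁ , indep
      with homogenise (λ (j , k) x y → a j k x ℚ.≤ a j k y) (λ _ _ _ → _ ℚ.≤? _) functions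
             (suc (size₂ s)) (elems R₁) (sorted R₁) (λ _ → inj₁ λ _ _ _ _ _ → ℚ.≤-trans) (long R₁)
    ... | R₂ , mono
      with splitLast (size₂ s) (elems R₂) (sorted R₂) (long R₂)
    ... | w , w∈ , R₃ , <w
      -- With the third point fixed at `w`, concavity reads `f x + f w ≤ f y + f y`: a threshold
      -- relation whose right side is already monotone.
      with homogenise (λ (j , k) x y → Concave (a j k) x y w) (λ _ _ _ → _ ℚ.≤? _) functions
             (suc (size₃ s)) (elems R₃) (sorted R₃)
             (λ {(j , k)} i∈ → threshold-transitive (λ x → a j k x ℚ.+ a j k w) _
               (monotone-map (λ p → p ℚ.+ p) (λ p≤q → ℚ.+-mono-≤ p≤q p≤q)
                 (restrict R₃ (mono i∈))))
             (long R₃)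
      where
      restrict : ∀ {n ys f} (R : Subsequence {N} n ys) → Homogeneous ys (λ x y → f x ℚ.≤ f y) →
        Monotone (elems R) f
      restrict R (inj₁ m) = inj₁ λ x∈ y∈ → m (included R x∈) (included R y∈)
      restrict R (inj₂ m) = inj₂ λ x∈ y∈ x<y → ≰⇒≥ (m (included R x∈) (included R y∈) x<y)
    ... | subsequence (b ∷ us) inc (b< ∷ so′) (s≤s l′) , conc =
      subsequence us (included R₁ ∘ included R₂ ∘ included R₃ ∘ inc ∘ there) so′ l′ ,
      λ j k → normalise {ys = elems R₂} (included R₃ ∘ inc ∘ there) (included R₃ (inc (here refl))) w∈
        (All.lookup b<) (<w ∘ inc ∘ there) (mono (∈-functions (j , k)))
        (λ x∈ y∈ z∈ v∈ → indep (∈-functions (j , k))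
          (included R₂ x∈) (included R₂ y∈) (included R₂ z∈) (included R₂ v∈))
        (conc (∈-functions (j , k)))

    module _ {xs} (nf : ∀ j k → NormalForm xs (a j k)) where

      total : J → ℚ
      total j = c j ℚ.+ sum (λ k → const (nf j k))

      sgn : J → Fin (suc r) → Bool
      sgn j zero    = ⌊ 0ℚ ℚ.≤? total j ⌋
      sgn j (suc k) = sign (nf j k)

      magnitude : J → Fin (suc r) → Fin N → ℚ
      magnitude j zero    x = ℚ.∣ total j ∣
      magnitude j (suc k) x = size (nf j k) x

      magnitude-nonneg : ∀ j k {x} → x ∈ₗ xs → 0ℚ ℚ.≤ magnitude j k x
      magnitude-nonneg j zero    x∈ = ℚ.0≤∣p∣ (total j)
      magnitude-nonneg j (suc k) x∈ = nonneg (nf j k) x∈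

      magnitude-monotone : ∀ j k → Monotone xs (magnitude j k)
      magnitude-monotone j zero    = inj₁ λ _ _ _ → ℚ.≤-refl
      magnitude-monotone j (suc k) = doubling⇒monotone (nonneg (nf j k)) (doubling (nf j k))

      total-signed : ∀ j x → total j ≡ signed (sgn j zero) (magnitude j zero x)
      total-signed j x with 0ℚ ℚ.≤? total j
      ... | yes 0≤t = sym (ℚ.0≤p⇒∣p∣≡p 0≤t)
      ... | no  0≰t = trans (solve 1 (λ t → t := :- (:- t)) refl (total j)) (cong ℚ.-_ (sym
        (trans (sym (ℚ.∣-p∣≡∣p∣ (total j)))
          (ℚ.0≤p⇒∣p∣≡p (ℚ.neg-antimono-≤ (≰⇒≥ 0≰t))))))

      -- The constant is evaluated at a point x₀ below all others, which makes
      -- it one more summand.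
      with-base : Fin N → (Fin r → Fin N) → Fin (suc r) → Fin N
      with-base x₀ x zero    = x₀
      with-base x₀ x (suc k) = x k

      value : ∀ j x₀ (x : Fin r → Fin N) → c j ℚ.+ sum (λ k → a j k (x k)) ≡
        sum (λ k → signed (sgn j k) (magnitude j k (with-base x₀ x k)))
      value j x₀ x = begin
        c j ℚ.+ sum (λ k → a j k (x k))
          ≡⟨ cong (c j ℚ.+_) (sum-cong-≗ λ k → split (nf j k) (x k)) ⟩
        c j ℚ.+ sum (λ k → const (nf j k) ℚ.+ signed (sign (nf j k)) (size (nf j k) (x k)))
          ≡⟨ cong (c j ℚ.+_) (∑-distrib-+ (λ k → const (nf j k)) _) ⟩
        c j ℚ.+ (sum (λ k → const (nf j k)) ℚ.+ rest)
          ≡⟨ ℚ.+-assoc (c j) _ _ ⟨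
        total j ℚ.+ rest
          ≡⟨ cong (ℚ._+ rest) (total-signed j x₀) ⟩
        signed (sgn j zero) (magnitude j zero x₀) ℚ.+ rest ∎
        where
        open ≡-Reasoning
        rest : ℚ
        rest = sum (λ k → signed (sign (nf j k)) (size (nf j k) (x k)))

      private
        T : ℚ
        T = fromℕ (2 ℕ.+ r)

        0≤T : 0ℚ ℚ.≤ T
        0≤T = fromℕ-nonneg (2 ℕ.+ r)

      -- Kinds 0F and 1F compare the k-th and l-th magnitudes in both directions;
      -- kind 2F asks whether the l-th one vanishes.
      left right : J × Fin (suc r) × Fin (suc r) × Fin 3 → Fin N → ℚ
      left (j , k , l , 0F) x = T ℚ.* magnitude j k x
      left (j , k , l , 1F) x = ℚ.- magnitude j k x
      left (j , k , l , 2F) x = 0ℚ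
      right (j , k , l , 0F) y = magnitude j l y
      right (j , k , l , 1F) y = ℚ.- (T ℚ.* magnitude j l y)
      right (j , k , l , 2F) y = ℚ.- magnitude j l y

      right-monotone : ∀ i → Monotone xs (right i)
      right-monotone (j , k , l , 0F) = magnitude-monotone j l
      right-monotone (j , k , l , 1F) =
        monotone-neg (monotone-map (T ℚ.*_) (*-monoˡ-≤ 0≤T) (magnitude-monotone j l))
      right-monotone (j , k , l , 2F) = monotone-neg (magnitude-monotone j l)

      module _ {x₀ ys} (inc : ∀ {x} → x ∈ₗ (x₀ ∷ ys) → x ∈ₗ xs) (so : Sorted (x₀ ∷ ys))
        (long-ys : square (2 ℕ.+ r) ℕ.≤ length ys)
        (hom : ∀ i → Homogeneous (x₀ ∷ ys) (λ x y → left i x ℚ.≤ right i y)) where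

        private
          x₀< : ∀ {x} → x ∈ₗ ys → x₀ Fin.< x
          x₀< = All.lookup (AllPairs.head so)

          restrict : ∀ {h} → Doubling xs h → Doubling ys h
          restrict (inj₁ d) = inj₁ λ x∈ y∈ → d (inc (there x∈)) (inc (there y∈))
          restrict (inj₂ d) = inj₂ λ x∈ y∈ → d (inc (there x∈)) (inc (there y∈))

        -- If both comparisons failed, the value of the `k`-th magnitude at `x₀` would be within a
        -- factor `T` of every value of the `l`-th on `ys`, so the latter could not vary by `T * T`,
        -- against `spread`. As `k < l`, the `l`-th is never the constant and does double.
        dominates : ∀ j k l → k Fin.< l →
          OnPairs (x₀ ∷ ys) (λ x y → T ℚ.* magnitude j k x ℚ.≤ magnitude j l y) ⊎
          OnPairs (x₀ ∷ ys) (λ x y → T ℚ.* magnitude j l y ℚ.≤ magnitude j k x)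
        dominates j k (suc l) k<l with hom (j , k , suc l , 0F) | hom (j , k , suc l , 1F)
        ... | inj₁ h | _ = inj₁ h
        ... | inj₂ _ | inj₁ h = inj₂ λ x∈ y∈ x<y → neg-cancel-≤ (h x∈ y∈ x<y)
        ... | inj₂ h | inj₂ h′
          with spread (2 ℕ.+ r) ys (AllPairs.tail so) (nonneg (nf j l) ∘ inc ∘ there)
                 (restrict (doubling (nf j l))) (ℕ.≤-trans (s≤s z≤n) long-ys) long-ys
        ...   | y , z , y∈ , z∈ , le = contradiction
          (ℚ.<-≤-trans (ℚ.≰⇒> (h (here refl) (there z∈) (x₀< z∈)))
            (ℚ.≤-trans (*-monoˡ-≤ 0≤T (≰⇒≥ (h′ (here refl) (there y∈) (x₀< y∈) ∘ ℚ.neg-antimono-≤))) le))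
          (ℚ.<-irrefl refl)

        same-sign-from : SameSign ys
        same-sign-from j x y incx incy x∈ y∈ 0< =
          subst (0ℚ ℚ.<_) (sym (value j x₀ y))
            (sign-determined (sgn j) (λ k → magnitude j k (X k)) (λ k → magnitude j k (Y k))
              (λ k → magnitude-nonneg j k (inc (X∈ k))) (λ k → magnitude-nonneg j k (inc (Y∈ k)))
              positive compare (subst (0ℚ ℚ.<_) (value j x₀ x) 0<))
          where
          X Y : Fin (suc r) → Fin N
          X = with-base x₀ x
          Y = with-base x₀ y
          base∈ : ∀ {z : Fin r → Fin N} → (∀ k → z k ∈ₗ ys) → ∀ k → with-base x₀ z k ∈ₗ (x₀ ∷ ys)
          base∈ z∈ zero    = here refl
          base∈ z∈ (suc k) = there (z∈ k)
          base-increasing : ∀ {z : Fin r → Fin N} → (∀ k → z k ∈ₗ ys) → Increasing z →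
            Increasing (with-base x₀ z)
          base-increasing z∈ incz {zero}  {suc l} _         = x₀< (z∈ l)
          base-increasing z∈ incz {suc k} {suc l} (s≤s k<l) = incz k<l
          X∈ : ∀ k → X k ∈ₗ (x₀ ∷ ys)
          X∈ = base∈ x∈
          Y∈ : ∀ k → Y k ∈ₗ (x₀ ∷ ys)
          Y∈ = base∈ y∈
          positive : ∀ k → 0ℚ ℚ.< magnitude j k (X k) → 0ℚ ℚ.< magnitude j k (Y k)
          positive zero    0<v = 0<v
          -- Read at pairs starting from `x₀`, kind 2F says that the magnitude vanishes on all of
          -- `ys` or nowhere on it.
          positive (suc k) 0<v with hom (j , suc k , suc k , 2F)
          ... | inj₁ h = contradiction
            (ℚ.<-≤-trans 0<v (neg-cancel-≤ (h (here refl) (there (x∈ k)) (x₀< (x∈ k)))))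
            (ℚ.<-irrefl refl)
          ... | inj₂ h = ℚ.≰⇒> (h (here refl) (there (y∈ k)) (x₀< (y∈ k)) ∘ ℚ.neg-antimono-≤)
          below : ∀ k l → k Fin.< l →
            (T ℚ.* magnitude j k (X k) ℚ.≤ magnitude j l (X l) ×
             T ℚ.* magnitude j k (Y k) ℚ.≤ magnitude j l (Y l)) ⊎
            (T ℚ.* magnitude j l (X l) ℚ.≤ magnitude j k (X k) ×
             T ℚ.* magnitude j l (Y l) ℚ.≤ magnitude j k (Y k))
          below k l k<l with dominates j k l k<l
          ... | inj₁ h = inj₁ (h (X∈ k) (X∈ l) (base-increasing x∈ incx k<l) ,
                               h (Y∈ k) (Y∈ l) (base-increasing y∈ incy k<l))
          ... | inj₂ h = inj₂ (h (X∈ k) (X∈ l) (base-increasing x∈ incx k<l) ,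
                               h (Y∈ k) (Y∈ l) (base-increasing y∈ incy k<l))
          compare : ∀ k l → k ≢ l →
            (T ℚ.* magnitude j k (X k) ℚ.≤ magnitude j l (X l) ×
             T ℚ.* magnitude j k (Y k) ℚ.≤ magnitude j l (Y l)) ⊎
            (T ℚ.* magnitude j l (X l) ℚ.≤ magnitude j k (X k) ×
             T ℚ.* magnitude j l (Y l) ℚ.≤ magnitude j k (Y k))
          compare k l k≢l with Fin.<-cmp k l
          ... | tri< k<l _ _ = below k l k<l
          ... | tri≈ _ k≡l _ = contradiction k≡l k≢l
          ... | tri> _ _ l<k = Sum.swap (below l k l<k)

    same-sign : ∀ s xs → Sorted xs → 2 ℕ.^ exponent s ℕ.≤ length xs →
      ∃ λ (S : Subsequence s xs) → SameSign (elems S)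
    same-sign s xs so l with normal-sequences s xs so l
    ... | R , nf with homogenise (λ i x y → left nf i x ℚ.≤ right nf i y) (λ _ _ _ → _ ℚ.≤? _)
                        comparisons (suc (s ℕ.+ square (2 ℕ.+ r))) (elems R) (sorted R)
                        (λ {i} _ → threshold-transitive (left nf i) (right nf i) (right-monotone nf i))
                        (long R)
    ... | subsequence (x₀ ∷ ys) inc so′@(_ ∷ so″) (s≤s l′) , hom =
      subsequence ys (included R ∘ inc ∘ there) so″ (ℕ.m+n≤o⇒m≤o s l′) ,
      same-sign-from nf inc so′ (ℕ.m+n≤o⇒n≤o s l′) (λ i → hom (∈-comparisons i))

-- Signs of real numbers and rational approximations

p≤∣p∣ : ∀ p → p ℚ.≤ ℚ.∣ p ∣
p≤∣p∣ p with ℚ.∣p∣≡p∨∣p∣≡-p p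
... | inj₁ eq = ℚ.≤-reflexive (sym eq)
... | inj₂ eq = ℚ.≤-trans (neg-cancel-≤ {0ℚ} (subst (0ℚ ℚ.≤_) eq (ℚ.0≤∣p∣ p))) (ℚ.0≤∣p∣ p)

∣p∣<⇒p< : ∀ {p q} → ℚ.∣ p ∣ ℚ.< q → p ℚ.< q
∣p∣<⇒p< {p} = ℚ.≤-<-trans (p≤∣p∣ p)

∣p∣<⇒-q<p : ∀ {p q} → ℚ.∣ p ∣ ℚ.< q → ℚ.- q ℚ.< p
∣p∣<⇒-q<p {p} {q} l = rearrange-< (∣p∣<⇒p< (subst (ℚ._< q) (sym (ℚ.∣-p∣≡∣p∣ p)) l))
  (solve 2 (λ p q → q :- :- p := p :- :- q) refl p q)

<⇒∣p∣< : ∀ {p q} → ℚ.- q ℚ.< p → p ℚ.< q → ℚ.∣ p ∣ ℚ.< q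
<⇒∣p∣< {p} {q} l u with ℚ.∣p∣≡p∨∣p∣≡-p p
... | inj₁ eq = subst (ℚ._< q) (sym eq) u
... | inj₂ eq = subst (ℚ._< q) (sym eq) (rearrange-< l (solve 2 (λ p q → p :- :- q := q :- :- p) refl p q))

halve : ∀ {ε} → 0ℚ ℚ.< ε → ∃ λ δ → 0ℚ ℚ.< δ × δ ℚ.+ δ ≡ ε
halve {ε} ε>0 = ½ ℚ.* ε , subst (ℚ._< ½ ℚ.* ε) (ℚ.*-zeroʳ ½) (ℚ.*-monoʳ-<-pos ½ ε>0) ,
  trans (sym (ℚ.*-distribʳ-+ ε ½ ½)) (ℚ.*-identityˡ ε)

-- Write `ε = 4δ` and take `M` from the Cauchy property for `δ`. A value of `seq x M` beyond `2δ` or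
-- `- 2δ` would give `x` a strict sign; comparison of rationals being decidable, later terms stay
-- within `3δ`.
≮∧≯⇒≃0 : ∀ x → ¬ 0ℝ < x → ¬ x < 0ℝ → x ≃ 0ℝ
≮∧≯⇒≃0 x ≯0 ≮0 ε ε>0 with halve ε>0
... | η , η>0 , refl with halve η>0
...   | δ , δ>0 , refl with cauchy x δ δ>0
...     | M , close = M , λ n M≤n → <⇒∣p∣<
  (rearrange-< (ℚ.+-mono-<-≤ (above n M≤n) (ℚ.+-mono-≤ lower (ℚ.<⇒≤ (ℚ.neg-antimono-< δ>0))))
    (solve 3 (λ x y d → (x :- y :+ (y :+ con 0ℚ)) :- (:- d :+ (:- (d :+ d) :+ :- d))
                      := x :- con 0ℚ :- :- (d :+ d :+ (d :+ d))) refl (seq x n) (seq x M) δ))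
  (rearrange-< (ℚ.+-mono-<-≤ (below n M≤n) (ℚ.+-mono-≤ upper (ℚ.<⇒≤ δ>0)))
    (solve 3 (λ x y d → (d :+ (d :+ d :+ d)) :- (x :- y :+ (y :+ con 0ℚ))
                      := d :+ d :+ (d :+ d) :- (x :- con 0ℚ)) refl (seq x n) (seq x M) δ))
  where
  above : ∀ n → M ℕ.≤ n → ℚ.- δ ℚ.< seq x n ℚ.- seq x M
  above n M≤n = ∣p∣<⇒-q<p (close n M M≤n ℕ.≤-refl)
  below : ∀ n → M ℕ.≤ n → seq x n ℚ.- seq x M ℚ.< δ
  below n M≤n = ∣p∣<⇒p< (close n M M≤n ℕ.≤-refl)
  upper : seq x M ℚ.≤ δ ℚ.+ δ
  upper = ℚ.≮⇒≥ λ 2δ<x → ≯0 (δ , δ>0 , M , λ n M≤n → rearrange-< (ℚ.+-mono-< (above n M≤n) 2δ<x)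
    (solve 3 (λ x y d → x :- y :+ y :- (:- d :+ (d :+ d)) := x :- (con 0ℚ :+ d)) refl
      (seq x n) (seq x M) δ))
  lower : ℚ.- (δ ℚ.+ δ) ℚ.≤ seq x M
  lower = ℚ.≮⇒≥ λ x<-2δ → ≮0 (δ , δ>0 , M , λ n M≤n → rearrange-< (ℚ.+-mono-< (below n M≤n) x<-2δ)
    (solve 3 (λ x y d → d :+ :- (d :+ d) :- (x :- y :+ y) := con 0ℚ :- (x :+ d)) refl
      (seq x n) (seq x M) δ))

-- Refuting both strict signs already proves that `x` is zero, so no sign at all is contradictory.
¬¬-sign : ∀ x → ¬ ¬ ∃ (HasSign x)
¬¬-sign x ∄ = ∄ (zer , ≮∧≯⇒≃0 x (λ x>0 → ∄ (pos , x>0)) (λ x<0 → ∄ (neg , x<0)))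

¬¬-all : ∀ {A : Set} {P : A → Set} xs → (∀ x → ¬ ¬ P x) → ¬ ¬ (∀ {x} → x ∈ₗ xs → P x)
¬¬-all []       h k = k λ ()
¬¬-all (x ∷ xs) h k = h x λ px → ¬¬-all xs h λ pxs →
  k λ { (here refl) → px ; (there x∈) → pxs x∈ }

-- The sign s of a real number is recognised from an approximation q of it by
-- comparing q with ±ε.
Recognised : ℚ → Sign → ℚ → Set
Recognised ε pos q = ε ℚ.< q
Recognised ε neg q = q ℚ.< ℚ.- ε
Recognised ε zer q = ℚ.- ε ℚ.< q × q ℚ.< ε

-- Stated for every `ε` up to some `ε₀`, so that finitely many numbers can share the least of their
-- tolerances.
recognised : ∀ x s → HasSign x s → ∃ λ ε₀ → 0ℚ ℚ.< ε₀ ×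
  (∀ ε → 0ℚ ℚ.< ε → ε ℚ.≤ ε₀ → Eventually λ n → Recognised ε s (seq x n))
recognised x pos (ε₀ , ε₀>0 , M , h) = ε₀ , ε₀>0 , λ ε ε>0 ε≤ε₀ → M , λ n M≤n →
  ℚ.≤-<-trans ε≤ε₀ (subst (ℚ._< seq x n) (ℚ.+-identityˡ ε₀) (h n M≤n))
recognised x neg (ε₀ , ε₀>0 , M , h) = ε₀ , ε₀>0 , λ ε ε>0 ε≤ε₀ → M , λ n M≤n →
  rearrange-< (ℚ.≤-<-trans (ℚ.+-monoʳ-≤ (seq x n) ε≤ε₀) (h n M≤n))
    (solve 2 (λ x e → con 0ℚ :- (x :+ e) := :- e :- x) refl (seq x n) ε)
-- Any tolerance works for zero; `1ℚ` is an arbitrary cap.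
recognised x zer x≃0 = 1ℚ , ℚ.positive⁻¹ 1ℚ , λ ε ε>0 _ →
  let M , h = x≃0 ε ε>0
      x-0 = λ n → solve 1 (λ x → x :- con 0ℚ := x) refl (seq x n)
  in M , λ n M≤n → subst (ℚ.- ε ℚ.<_) (x-0 n) (∣p∣<⇒-q<p (h n M≤n)) ,
                   subst (ℚ._< ε) (x-0 n) (∣p∣<⇒p< (h n M≤n))

common-ε : ∀ {Q : Set} {P : Q → ℚ → Set} →
  (∀ q → ∃ λ ε₀ → 0ℚ ℚ.< ε₀ × (∀ ε → 0ℚ ℚ.< ε → ε ℚ.≤ ε₀ → P q ε)) → ∀ qs →
  ∃ λ ε₀ → 0ℚ ℚ.< ε₀ × (∀ ε → 0ℚ ℚ.< ε → ε ℚ.≤ ε₀ → ∀ {q} → q ∈ₗ qs → P q ε)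
common-ε h [] = 1ℚ , ℚ.positive⁻¹ 1ℚ , λ _ _ _ ()
common-ε h (q ∷ qs) with h q | common-ε h qs
... | ε₁ , ε₁>0 , h₁ | ε₂ , ε₂>0 , h₂ with ℚ.≤-total ε₁ ε₂
...   | inj₁ ε₁≤ε₂ = ε₁ , ε₁>0 , λ where
  ε ε>0 ε≤ (here refl) → h₁ ε ε>0 ε≤
  ε ε>0 ε≤ (there q∈)  → h₂ ε ε>0 (ℚ.≤-trans ε≤ ε₁≤ε₂) q∈
...   | inj₂ ε₂≤ε₁ = ε₂ , ε₂>0 , λ where
  ε ε>0 ε≤ (here refl) → h₁ ε ε>0 (ℚ.≤-trans ε≤ ε₂≤ε₁)
  ε ε>0 ε≤ (there q∈)  → h₂ ε ε>0 ε≤ q∈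

eventually-all : ∀ {Q : Set} {P : Q → ℕ → Set} qs → (∀ {q} → q ∈ₗ qs → Eventually (P q)) →
  Eventually λ n → ∀ {q} → q ∈ₗ qs → P q n
eventually-all [] h = 0 , λ _ _ ()
eventually-all (q ∷ qs) h with h (here refl) | eventually-all qs (h ∘ there)
... | M₁ , h₁ | M₂ , h₂ = M₁ ℕ.⊔ M₂ , λ where
  n M≤n (here refl) → h₁ n (ℕ.m⊔n≤o⇒m≤o M₁ M₂ M≤n)
  n M≤n (there q∈)  → h₂ n (ℕ.m⊔n≤o⇒n≤o M₁ M₂ M≤n) q∈

approximate : ∀ {Q : Set} (qs : List Q) → (∀ q → q ∈ₗ qs) → (x : Q → ℝ) (s : Q → Sign) →
  (∀ q → HasSign (x q) (s q)) →
  ∃ λ ε → 0ℚ ℚ.< ε × ∃ λ n → ∀ q → Recognised ε (s q) (seq (x q) n)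
approximate qs complete x s h =
  let ε , ε>0 , hε = common-ε (λ q → recognised (x q) (s q) (h q)) qs
      n , hn = eventually-all qs (hε ε ε>0 ℚ.≤-refl)
  in ε , ε>0 , n , λ q → hn n ℕ.≤-refl (complete q)

-- Positivity of `- ε + q` and of `- ε + - q` tells the three signs apart. These two are sums of the
-- kind treated by `SameSign`, with constant `- ε`.
recognised-unique : ∀ {ε} → 0ℚ ℚ.< ε → ∀ s s′ {q q′} → Recognised ε s q → Recognised ε s′ q′ →
  (0ℚ ℚ.< ℚ.- ε ℚ.+ q → 0ℚ ℚ.< ℚ.- ε ℚ.+ q′) → (0ℚ ℚ.< ℚ.- ε ℚ.+ q′ → 0ℚ ℚ.< ℚ.- ε ℚ.+ q) →
  (0ℚ ℚ.< ℚ.- ε ℚ.+ ℚ.- q → 0ℚ ℚ.< ℚ.- ε ℚ.+ ℚ.- q′) →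
  (0ℚ ℚ.< ℚ.- ε ℚ.+ ℚ.- q′ → 0ℚ ℚ.< ℚ.- ε ℚ.+ ℚ.- q) → s ≡ s′
recognised-unique {ε} ε>0 s s′ {q} {q′} = go s s′
  where
  up : ∀ {q} → ε ℚ.< q → 0ℚ ℚ.< ℚ.- ε ℚ.+ q
  up {q} l = rearrange-< l (solve 2 (λ e q → q :- e := :- e :+ q :- con 0ℚ) refl ε q)
  up⁻ : ∀ {q} → 0ℚ ℚ.< ℚ.- ε ℚ.+ q → ε ℚ.< q
  up⁻ {q} l = rearrange-< l (solve 2 (λ e q → :- e :+ q :- con 0ℚ := q :- e) refl ε q)
  dn : ∀ {q} → q ℚ.< ℚ.- ε → 0ℚ ℚ.< ℚ.- ε ℚ.+ ℚ.- q
  dn {q} l = rearrange-< l (solve 2 (λ e q → :- e :- q := :- e :+ :- q :- con 0ℚ) refl ε q)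
  dn⁻ : ∀ {q} → 0ℚ ℚ.< ℚ.- ε ℚ.+ ℚ.- q → q ℚ.< ℚ.- ε
  dn⁻ {q} l = rearrange-< l (solve 2 (λ e q → :- e :+ :- q :- con 0ℚ := :- e :- q) refl ε q)
  not-both : ∀ {q} → ε ℚ.< q → ¬ q ℚ.< ℚ.- ε
  not-both l u = ℚ.<-irrefl refl (ℚ.<-trans (ℚ.<-trans ε>0 l) (ℚ.<-trans u (ℚ.neg-antimono-< ε>0)))
  go : ∀ s s′ → Recognised ε s q → Recognised ε s′ q′ → _ → _ → _ → _ → s ≡ s′
  go pos pos _ _ _ _ _ _ = refl
  go neg neg _ _ _ _ _ _ = refl
  go zer zer _ _ _ _ _ _ = refl
  go pos neg h h′ f _ _ _ = contradiction h′ (not-both (up⁻ (f (up h))))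
  go pos zer h (_ , h′) f _ _ _ = contradiction h′ (ℚ.<-asym (up⁻ (f (up h))))
  go neg pos h h′ _ f _ _ = contradiction h (not-both (up⁻ (f (up h′))))
  go zer pos (_ , h) h′ _ f _ _ = contradiction h (ℚ.<-asym (up⁻ (f (up h′))))
  go neg zer h (h′ , _) _ _ f _ = contradiction h′ (ℚ.<-asym (dn⁻ (f (dn h))))
  go zer neg (h , _) h′ _ _ _ f = contradiction h (ℚ.<-asym (dn⁻ (f (dn h′))))

-- Splitting polynomials of degree at most 1 into functions of single blocks

blocks : ∀ r {d} → (Fin r → Vec ℝ d) → Vec ℝ (r ℕ.* d)
blocks r B = Vec.concat (Vec.tabulate B)

module _ (n : ℕ) where

  monomial : ∀ {l} → Vec ℝ l → Vec ℕ l → ℚ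
  monomial x e = seq (Vec.foldr′ _*_ 1ℝ (Vec.zipWith _^_ x e)) n

  monomial-++ : ∀ {l l′} (x : Vec ℝ l) (y : Vec ℝ l′) e e′ →
    monomial (x Vec.++ y) (e Vec.++ e′) ≡ monomial x e ℚ.* monomial y e′
  monomial-++ []      y []      e′ = sym (ℚ.*-identityˡ _)
  monomial-++ (u ∷ x) y (k ∷ e) e′ = trans (cong (seq (u ^ k) n ℚ.*_) (monomial-++ x y e e′))
    (sym (ℚ.*-assoc (seq (u ^ k) n) _ _))

  monomial-zero : ∀ {l} (x : Vec ℝ l) e → Vec.sum e ≡ 0 → monomial x e ≡ 1ℚ
  monomial-zero []      []         _ = refl
  monomial-zero (u ∷ x) (zero ∷ e) z = trans (ℚ.*-identityˡ _) (monomial-zero x e z)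

  -- An exact identity of rationals at the `n`-th approximation, so the combinatorial part can work
  -- with rational-valued functions.
  Separable : ∀ r d → ((Fin r → Vec ℝ d) → ℚ) → Set
  Separable r d F = ∃ λ (g : Fin r → Vec ℝ d → ℚ) → ∀ B → F B ≡ sum (λ k → g k (B k))

  -- A monomial of degree at most 1 depends on a single block.
  monomial-separable : ∀ r {d} (a : ℚ) (e : Vec ℕ (suc r ℕ.* d)) → Vec.sum e ℕ.≤ 1 →
    Separable (suc r) d λ B → a ℚ.* monomial (blocks (suc r) B) e
  monomial-separable r {d} a e le with Vec.splitAt d e
  ... | e₁ , e₂ , refl with Vec.sum e₂ in eq
  -- No later block occurs. Constant monomials land here too and are charged to the first block.
  ...   | zero = (λ { zero b → a ℚ.* monomial b e₁ ; (suc _) _ → 0ℚ }) , λ B → begin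
    a ℚ.* monomial (blocks (suc r) B) (e₁ Vec.++ e₂)
      ≡⟨ cong (a ℚ.*_) (monomial-++ (B zero) (blocks r (B ∘ suc)) e₁ e₂) ⟩
    a ℚ.* (monomial (B zero) e₁ ℚ.* monomial (blocks r (B ∘ suc)) e₂)
      ≡⟨ cong (λ t → a ℚ.* (monomial (B zero) e₁ ℚ.* t)) (monomial-zero (blocks r (B ∘ suc)) e₂ eq) ⟩
    a ℚ.* (monomial (B zero) e₁ ℚ.* 1ℚ)
      ≡⟨ cong (a ℚ.*_) (ℚ.*-identityʳ _) ⟩
    a ℚ.* monomial (B zero) e₁
      ≡⟨ ℚ.+-identityʳ _ ⟨
    a ℚ.* monomial (B zero) e₁ ℚ.+ 0ℚ
      ≡⟨ cong (a ℚ.* monomial (B zero) e₁ ℚ.+_) (sum-zero (λ (_ : Fin r) → 0ℚ) λ _ → refl) ⟨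
    a ℚ.* monomial (B zero) e₁ ℚ.+ sum {r} (λ _ → 0ℚ) ∎
    where open ≡-Reasoning
  monomial-separable zero {d} a _ le | e₁ , [] , refl | suc _ = contradiction eq λ ()
  -- A later block has positive exponent, which leaves exponent 0 for the first one.
  monomial-separable (suc r) {d} a _ le | e₁ , e₂ , refl | suc k =
    let g , h = monomial-separable r a e₂ (subst (ℕ._≤ 1) (sym eq) (ℕ.m+n≤o⇒n≤o (Vec.sum e₁) le′))
    in (λ { zero _ → 0ℚ ; (suc l) → g l }) , λ B → begin
    a ℚ.* monomial (blocks (suc (suc r)) B) (e₁ Vec.++ e₂)
      ≡⟨ cong (a ℚ.*_) (monomial-++ (B zero) (blocks (suc r) (B ∘ suc)) e₁ e₂) ⟩
    a ℚ.* (monomial (B zero) e₁ ℚ.* monomial (blocks (suc r) (B ∘ suc)) e₂)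
      ≡⟨ cong (λ t → a ℚ.* (t ℚ.* monomial (blocks (suc r) (B ∘ suc)) e₂)) (monomial-zero (B zero) e₁ e₁-zero) ⟩
    a ℚ.* (1ℚ ℚ.* monomial (blocks (suc r) (B ∘ suc)) e₂)
      ≡⟨ cong (a ℚ.*_) (ℚ.*-identityˡ _) ⟩
    a ℚ.* monomial (blocks (suc r) (B ∘ suc)) e₂
      ≡⟨ h (B ∘ suc) ⟩
    sum (λ l → g l (B (suc l)))
      ≡⟨ ℚ.+-identityˡ _ ⟨
    0ℚ ℚ.+ sum (λ l → g l (B (suc l))) ∎
    where
    open ≡-Reasoning
    le′ : Vec.sum e₁ ℕ.+ suc k ℕ.≤ 1
    le′ = subst (ℕ._≤ 1) (trans (Vec.sum-++ e₁) (cong (Vec.sum e₁ ℕ.+_) eq)) le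
    e₁-zero : Vec.sum e₁ ≡ 0
    e₁-zero = ℕ.n≤0⇒n≡0 (ℕ.m+n≤o⇒m≤o (Vec.sum e₁)
      (ℕ.≤-pred (subst (ℕ._≤ 1) (ℕ.+-suc (Vec.sum e₁) k) le′)))

  polynomial-separable : ∀ r {d} (f : Polynomial (suc r ℕ.* d)) → DegreeAtMost 1 f →
    Separable (suc r) d λ B → seq (eval f (blocks (suc r) B)) n
  polynomial-separable r {d} [] [] = (λ _ _ → 0ℚ) , λ B → sym (sum-zero {suc r} (λ _ → 0ℚ) λ _ → refl)
  polynomial-separable r {d} ((a , e) ∷ f) (le ∷ les) =
    let g , h = monomial-separable r (seq a n) e le
        g′ , h′ = polynomial-separable r f les
    in (λ k b → g k b ℚ.+ g′ k b) , λ B → trans (cong₂ ℚ._+_ (h B) (h′ B))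
         (sym (∑-distrib-+ (λ k → g k (B k)) (λ k → g′ k (B k))))

-- Sets of vertices and semi-algebraic colourings

∈-setOf⁺ : ∀ {r N} (v : Fin r → Fin N) k → v k ∈ setOf v
∈-setOf⁺ v zero    = Subset.x∈p∪q⁺ (inj₁ (Subset.x∈⁅x⁆ (v zero)))
∈-setOf⁺ v (suc k) = Subset.x∈p∪q⁺ (inj₂ (∈-setOf⁺ (v ∘ suc) k))

∈-setOf⁻ : ∀ {r N} (v : Fin r → Fin N) {x} → x ∈ setOf v → ∃ λ k → v k ≡ x
∈-setOf⁻ {zero}  v x∈ = contradiction x∈ Subset.∉⊥
∈-setOf⁻ {suc r} v x∈ with Subset.x∈p∪q⁻ ⁅ v zero ⁆ (setOf (v ∘ suc)) x∈
... | inj₁ x∈₀ = zero , sym (Subset.x∈⁅y⁆⇒x≡y (v zero) x∈₀)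
... | inj₂ x∈₊ = let k , eq = ∈-setOf⁻ (v ∘ suc) x∈₊ in suc k , eq

record Enumeration {N} (e : Subset N) (r : ℕ) : Set where
  field
    element    : Fin r → Fin N
    increasing : Increasing element
    sound      : ∀ k → element k ∈ e
    exhaustive : ∀ {x} → x ∈ e → ∃ λ k → element k ≡ x

open Enumeration

enumerate : ∀ {N} (e : Subset N) → Enumeration e ∣ e ∣
enumerate [] = record
  { element = λ () ; increasing = λ { {()} } ; sound = λ () ; exhaustive = λ () }
enumerate (outside ∷ e) = record
  { element    = suc ∘ element E
  ; increasing = s≤s ∘ increasing E
  ; sound      = λ k → there (sound E k)
  ; exhaustive = λ { (there x∈) → let k , eq = exhaustive E x∈ in k , cong suc eq } }
  where E = enumerate e
enumerate {suc N} (inside ∷ e) = record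
  { element    = elt
  ; increasing = λ { {zero} {suc b} _ → s≤s z≤n ; {suc a} {suc b} (s≤s a<b) → s≤s (increasing E a<b) }
  ; sound      = λ { zero → here ; (suc k) → there (sound E k) }
  ; exhaustive = λ { here → zero , refl
                   ; (there x∈) → let k , eq = exhaustive E x∈ in suc k , cong suc eq } }
  where
  E = enumerate e
  elt : Fin (suc ∣ e ∣) → Fin (suc N)
  elt zero    = zero
  elt (suc k) = suc (element E k)

increasing⇒injective : ∀ {r N} {v : Fin r → Fin N} → Increasing v → ∀ {a b} → v a ≡ v b → a ≡ b
increasing⇒injective inc {a} {b} eq with Fin.<-cmp a b
... | tri< a<b _ _ = contradiction (inc a<b) (Fin.<-irrefl eq)
... | tri≈ _ a≡b _ = a≡b
... | tri> _ _ b<a = contradiction (inc b<a) (Fin.<-irrefl (sym eq))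

lookup-increasing : ∀ {N} {xs : List (Fin N)} → Sorted xs → Increasing (List.lookup xs)
lookup-increasing (x< ∷ so) {zero}  {suc b} _         = All.lookup x< (List.∈-lookup b)
lookup-increasing (x< ∷ so) {suc a} {suc b} (s≤s a<b) = lookup-increasing so a<b

-- Sending `k` to the rank of `v k` in the enumeration of the set is injective.
increasing⇒≤∣setOf∣ : ∀ {r N} {v : Fin r → Fin N} → Increasing v → r ℕ.≤ ∣ setOf v ∣
increasing⇒≤∣setOf∣ {v = v} inc = Fin.injective⇒≤ {f = λ k → proj₁ (index k)} λ {a} {b} eq →
  increasing⇒injective {v = v} inc (trans (sym (proj₂ (index a)))
    (trans (cong (element E) eq) (proj₂ (index b))))
  where
  E = enumerate (setOf v)
  index : ∀ k → ∃ λ l → element E l ≡ v k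
  index k = exhaustive E (∈-setOf⁺ v k)

fromList : ∀ {N} → List (Fin N) → Subset N
fromList xs = setOf (List.lookup xs)

∈-fromList⁻ : ∀ {N} (xs : List (Fin N)) {x} → x ∈ fromList xs → x ∈ₗ xs
∈-fromList⁻ xs x∈ with ∈-setOf⁻ (List.lookup xs) x∈
... | k , refl = List.∈-lookup k

opposite-anti : ∀ {n} {i j : Fin n} → i Fin.< j → Fin.opposite j Fin.< Fin.opposite i
opposite-anti {n} {i} {j} i<j = subst₂ ℕ._<_ (sym (Fin.opposite-prop j)) (sym (Fin.opposite-prop i))
  (ℕ.∸-monoʳ-< (s≤s i<j) (Fin.toℕ<n j))

-- A colour, one of its polynomials, and whether that polynomial or its negative is taken: both are
-- needed to recover a sign from positivity.
Family : ℕ → ℕ → Set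
Family p m = Fin p × Fin m × Bool

families : ∀ p m → List (Family p m)
families p m = List.cartesianProduct (List.allFin p)
  (List.cartesianProduct (List.allFin m) (true ∷ false ∷ []))

∈-families : ∀ {p m} (j : Family p m) → j ∈ₗ families p m
∈-families (κ , j , b) = List.∈-cartesianProduct⁺ (List.∈-allFin κ)
  (List.∈-cartesianProduct⁺ (List.∈-allFin j) (∈-bools b))
  where
  ∈-bools : ∀ b → b ∈ₗ (true ∷ false ∷ [])
  ∈-bools true  = here refl
  ∈-bools false = there (here refl)

-- The `p` squarings pay for making the enumeration of each colour class monotone in the common
-- vertex order.
cliqueBound : ℕ → ℕ → ℕ → ℕ → ℕ
cliqueBound r m p s = fold (2 ℕ.^ exponent (families p m) ∈-families r s) square p

-- From constant signs to a monochromatic clique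

module _ {r′ d m p N : ℕ} (χ : Colouring (suc r′) N p)
  (sa : ∀ κ → SemiAlgebraic d 1 m (colourClass χ κ)) where

  private
    r : ℕ
    r = suc r′

    module G κ = SemiAlgebraic (sa κ)

  position : Fin p → Fin N → Fin N
  position κ x = G.enum κ ⟨$⟩ˡ x

  position-injective : ∀ κ {x y} → position κ x ≡ position κ y → x ≡ y
  position-injective κ eq = trans (sym (Perm.inverseʳ (G.enum κ)))
    (trans (cong (G.enum κ ⟨$⟩ʳ_) eq) (Perm.inverseʳ (G.enum κ)))

  -- Tuples of positions are coded as numbers below `N ^ r`, so that all relevant real numbers are
  -- indexed by a finite list.
  Query : Set
  Query = Fin p × Fin m × Fin (N ℕ.^ r)

  queries : List Query
  queries = List.cartesianProduct (List.allFin p)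
    (List.cartesianProduct (List.allFin m) (List.allFin (N ℕ.^ r)))

  ∈-queries : ∀ q → q ∈ₗ queries
  ∈-queries (κ , j , t) = List.∈-cartesianProduct⁺ (List.∈-allFin κ)
    (List.∈-cartesianProduct⁺ (List.∈-allFin j) (List.∈-allFin t))

  answer : Query → ℝ
  answer (κ , j , t) = eval (G.f κ j) (blocks r (G.point κ ∘ finToFun t))

  -- Every colour class has its own enumeration. On `xs` it will follow or reverse the common order,
  -- and `π`, the identity or the reversal, reorders the blocks accordingly.
  record Oriented (κ : Fin p) (xs : List (Fin N)) : Set where
    field
      π          : Permutation′ r
      involutive : ∀ k → π ⟨$⟩ʳ (π ⟨$⟩ʳ k) ≡ k
      preserves  : ∀ {v : Fin r → Fin N} → Increasing v → (∀ k → v k ∈ₗ xs) →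
        Increasing (λ k → position κ (v (π ⟨$⟩ʳ k)))

  orient : ∀ κ xs → Homogeneous xs (λ x y → position κ x Fin.< position κ y) → Oriented κ xs
  orient κ xs (inj₁ h) = record { π = Perm.id ; involutive = λ _ → refl
    ; preserves = λ inc v∈ a<b → h (v∈ _) (v∈ _) (inc a<b) }
  orient κ xs (inj₂ h) = record { π = Perm.reverse ; involutive = Fin.opposite-involutive
    ; preserves = λ inc v∈ a<b → flip-< (v∈ _) (v∈ _) (inc (opposite-anti a<b)) }
    where
    flip-< : ∀ {x y} → x ∈ₗ xs → y ∈ₗ xs → x Fin.< y → position κ y Fin.< position κ x
    flip-< {x} {y} x∈ y∈ x<y with Fin.<-cmp (position κ x) (position κ y)
    ... | tri< lt _ _ = contradiction lt (h x∈ y∈ x<y)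
    ... | tri≈ _ eq _ = contradiction x<y (Fin.<-irrefl (position-injective κ eq))
    ... | tri> _ _ gt = gt

  module _ (s : Query → Sign) (s-correct : ∀ q → HasSign (answer q) (s q))
    {xs : List (Fin N)} (oriented : ∀ κ → Oriented κ xs) where

    private
      module O κ = Oriented (oriented κ)

    tuple : Fin p → (Fin r → Fin N) → Fin (N ℕ.^ r)
    tuple κ v = funToFin (λ k → position κ (v (O.π κ ⟨$⟩ʳ k)))

    tuple-position : ∀ κ v k → finToFun (tuple κ v) k ≡ position κ (v (O.π κ ⟨$⟩ʳ k))
    tuple-position κ v = Fin.finToFun-funToFin _

    module _ (ε : ℚ) (n : ℕ) where

      private
        sep : ∀ κ j → Separable n r d (λ B → seq (eval (G.f κ j) (blocks r B)) n)
        sep κ j = polynomial-separable n r′ (G.f κ j) (G.degree κ j)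

      -- Block `π k` of the polynomials of colour `κ` receives the `k`-th vertex of the common
      -- order, since `π` is an involution.
      summand : Family p m → Fin r → Fin N → ℚ
      summand (κ , j , b) k x =
        signed b (proj₁ (sep κ j) (O.π κ ⟨$⟩ʳ k) (G.point κ (position κ x)))

      summand-sum : ∀ κ j b v → sum (λ k → summand (κ , j , b) k (v k)) ≡
        signed b (seq (answer (κ , j , tuple κ v)) n)
      summand-sum κ j b v = trans (sum-signed b (λ k → g (π k) (pt (v k)))) (cong (signed b) (begin
        sum (λ k → g (π k) (pt (v k)))
          ≡⟨ sum-permute (λ k → g (π k) (pt (v k))) (O.π κ) ⟩
        sum (λ k → g (π (π k)) (pt (v (π k))))
          ≡⟨ sum-cong-≗ (λ k → cong₂ g (O.involutive κ k)
               (cong (G.point κ) (sym (tuple-position κ v k)))) ⟩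
        sum (λ k → g k (G.point κ (finToFun (tuple κ v) k)))
          ≡⟨ proj₂ (sep κ j) (G.point κ ∘ finToFun (tuple κ v)) ⟨
        seq (answer (κ , j , tuple κ v)) n ∎))
        where
        open ≡-Reasoning
        g : Fin r → Vec ℝ d → ℚ
        g = proj₁ (sep κ j)
        π : Fin r → Fin r
        π = O.π κ ⟨$⟩ʳ_
        pt : Fin N → Vec ℝ d
        pt x = G.point κ (position κ x)
        sum-signed : ∀ b (f : Fin r → ℚ) → sum (λ k → signed b (f k)) ≡ signed b (sum f)
        sum-signed true  f = refl
        sum-signed false f = sum-neg f

    signs : Fin p → (Fin r → Fin N) → Vec Sign m
    signs κ v = Vec.tabulate λ j → s (κ , j , tuple κ v)

    -- The increasing positions of the vertices of `e` are a reordering by `π` of its enumeration,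
    -- so mapping them back through `enum` yields the same set.
    edge⇔ : ∀ κ {e} → ∣ e ∣ ≡ r → (E : Enumeration e r) → (∀ k → element E k ∈ₗ xs) →
      κ ∈ colours χ e ⇔ Bool.T (G.Φ κ (signs κ (element E)))
    edge⇔ κ {e} ∣e∣≡r E E∈ = subst (λ X → (κ ∈ colours χ X) ⇔ Bool.T (G.Φ κ (signs κ (element E))))
      e-eq (mk⇔ (λ κ∈ → Equivalence.to equiv (trans (cong ∣_∣ e-eq) ∣e∣≡r , κ∈))
                (proj₂ ∘ Equivalence.from equiv))
      where
      v = element E
      i : Fin r → Fin N
      i = finToFun (tuple κ v)
      i-increasing : Increasing i
      i-increasing {a} {b} a<b = subst₂ Fin._<_ (sym (tuple-position κ v a)) (sym (tuple-position κ v b))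
        (O.preserves κ (increasing E) E∈ a<b)
      equiv = G.edge⇔Φ κ i i-increasing (signs κ v) λ j →
        subst (HasSign (answer (κ , j , tuple κ v))) (sym (Vec.lookup∘tabulate _ j))
          (s-correct (κ , j , tuple κ v))
      u : Fin r → Fin N
      u k = G.enum κ ⟨$⟩ʳ i k
      vertex : ∀ k → u k ≡ v (O.π κ ⟨$⟩ʳ k)
      vertex k = trans (cong (G.enum κ ⟨$⟩ʳ_) (tuple-position κ v k)) (Perm.inverseʳ (G.enum κ))
      e-eq : setOf u ≡ e
      e-eq = Subset.⊆-antisym
        (λ x∈ → let k , eq = ∈-setOf⁻ u x∈ in
          subst (_∈ e) (trans (sym (vertex k)) eq) (sound E (O.π κ ⟨$⟩ʳ k)))
        (λ x∈ → let k , eq = exhaustive E x∈ in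
          subst (_∈ setOf u)
            (trans (vertex (O.π κ ⟨$⟩ʳ k)) (trans (cong v (O.involutive κ k)) eq))
            (∈-setOf⁺ u (O.π κ ⟨$⟩ʳ k)))

    module _ {ys : List (Fin N)} (ys⊆ : ∀ {x} → x ∈ₗ ys → x ∈ₗ xs)
      {ε n} (ε>0 : 0ℚ ℚ.< ε) (rec : ∀ q → Recognised ε (s q) (seq (answer q) n))
      (same : SameSign (families p m) ∈-families r (summand ε n) (λ _ → ℚ.- ε) ys) where

      signs-const : ∀ κ v w → Increasing v → Increasing w → (∀ k → v k ∈ₗ ys) → (∀ k → w k ∈ₗ ys) →
        signs κ v ≡ signs κ w
      signs-const κ v w incv incw v∈ w∈ = Vec.tabulate-cong λ j →
        recognised-unique ε>0 _ _ (rec (κ , j , tuple κ v)) (rec (κ , j , tuple κ w))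
          (transfer j true v w incv incw v∈ w∈) (transfer j true w v incw incv w∈ v∈)
          (transfer j false v w incv incw v∈ w∈) (transfer j false w v incw incv w∈ v∈)
        where
        transfer : ∀ j b v w → Increasing v → Increasing w → (∀ k → v k ∈ₗ ys) → (∀ k → w k ∈ₗ ys) →
          0ℚ ℚ.< ℚ.- ε ℚ.+ signed b (seq (answer (κ , j , tuple κ v)) n) →
          0ℚ ℚ.< ℚ.- ε ℚ.+ signed b (seq (answer (κ , j , tuple κ w)) n)
        transfer j b v w incv incw v∈ w∈ =
          subst₂ (λ q q′ → 0ℚ ℚ.< ℚ.- ε ℚ.+ q → 0ℚ ℚ.< ℚ.- ε ℚ.+ q′)
            (summand-sum ε n κ j b v) (summand-sum ε n κ j b w)
            (same (κ , j , b) v w incv incw v∈ w∈)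

      -- The sign vector of each colour is the same on all increasing tuples, so a colour of one
      -- edge is a colour of every edge.
      monochromatic : Fin p → MonochromaticClique χ (fromList ys)
      monochromatic κ₀ with Subset.anySubset? (λ e → e Subset.⊆? fromList ys ×-dec ∣ e ∣ ℕ.≟ r)
      -- Without any edge inside the set, every colour works vacuously.
      ... | no ∄e = κ₀ , λ e e⊆ ∣e∣≡r → ⊥-elim (∄e (e , e⊆ , ∣e∣≡r))
      ... | yes (e₀ , e₀⊆ , ∣e₀∣≡r) =
        let κ , κ∈ = nonempty χ e₀ ∣e₀∣≡r
            E₀ = enumeration e₀ ∣e₀∣≡r
        in κ , λ e e⊆ ∣e∣≡r →
          let E = enumeration e ∣e∣≡r
          in Equivalence.from (edge⇔ κ ∣e∣≡r E (ys⊆ ∘ ∈ys E e⊆))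
            (subst (Bool.T ∘ G.Φ κ) (signs-const κ _ _ (increasing E₀) (increasing E) (∈ys E₀ e₀⊆) (∈ys E e⊆))
              (Equivalence.to (edge⇔ κ ∣e₀∣≡r E₀ (ys⊆ ∘ ∈ys E₀ e₀⊆)) κ∈))
        where
        enumeration : ∀ (e : Subset N) → ∣ e ∣ ≡ r → Enumeration e r
        enumeration e eq = subst (Enumeration e) eq (enumerate e)
        ∈ys : ∀ {e} (E : Enumeration e r) → e ⊆ fromList ys → ∀ k → element E k ∈ₗ ys
        ∈ys E e⊆ k = ∈-fromList⁻ ys (e⊆ (sound E k))

  LargeClique : ℕ → Set
  LargeClique size = ∃ λ (C : Subset N) → MonochromaticClique χ C × size ℕ.≤ ∣ C ∣

  clique-in : ∀ (s : Query → Sign) → (∀ q → HasSign (answer q) (s q)) → Fin p →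
    ∀ size {xs} → Sorted xs → (∀ κ → Oriented κ xs) →
    2 ℕ.^ exponent (families p m) ∈-families r size ℕ.≤ length xs → LargeClique size
  clique-in s s-correct κ₀ size {xs} so oriented l =
    from (approximate queries ∈-queries answer s s-correct)
    where
    from : (∃ λ ε → 0ℚ ℚ.< ε × ∃ λ n → ∀ q → Recognised ε (s q) (seq (answer q) n)) → LargeClique size
    from (ε , ε>0 , n , rec) = from′ (same-sign (families p m) ∈-families r (summand s s-correct oriented ε n)
                                    (λ _ → ℚ.- ε) size xs so l)
      where
      from′ : (∃ λ (S : Subsequence size xs) → SameSign (families p m) ∈-families r
                 (summand s s-correct oriented ε n) (λ _ → ℚ.- ε) (elems S)) → LargeClique size
      from′ (S , same) = fromList (elems S) ,
        monochromatic s s-correct oriented {ys = elems S} (included S) {ε} {n} ε>0 rec same κ₀ ,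
        ℕ.≤-trans (long S) (increasing⇒≤∣setOf∣ {v = List.lookup (elems S)} (lookup-increasing (sorted S)))

  -- The order of positions is transitive, so Dilworth aligns all enumerations first; the double
  -- negation covers the choice of the finitely many signs.
  ¬¬-clique : ∀ size → Fin p → cliqueBound r m p size ℕ.≤ N → ¬ ¬ LargeClique size
  ¬¬-clique size κ₀ l k = ¬¬-all queries (λ q → ¬¬-sign (answer q)) λ h →
    let R , hom = monotone-positions
    in k (clique-in (λ q → proj₁ (h (∈-queries q))) (λ q → proj₂ (h (∈-queries q))) κ₀ size
         (sorted R) (λ κ → orient κ (elems R) (hom (List.∈-allFin κ))) (long R))
    where
    bound : ℕ
    bound = 2 ℕ.^ exponent (families p m) ∈-families r size
    monotone-positions : ∃ λ (R : Subsequence bound (List.allFin N)) →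
      ∀ {κ} → κ ∈ₗ List.allFin p → Homogeneous (elems R) (λ x y → position κ x Fin.< position κ y)
    monotone-positions = homogenise (λ κ x y → position κ x Fin.< position κ y) (λ _ _ _ → _ Fin.<? _)
      (List.allFin p) bound (List.allFin N)
      (AllPairs.tabulate⁺-< id) (λ _ → inj₁ λ _ _ _ _ _ → Fin.<-trans)
      (subst₂ (λ a b → fold bound square a ℕ.≤ b)
        (sym (List.length-tabulate {n = p} id)) (sym (List.length-tabulate {n = N} id)) l)

-- Polynomial bounds and the clique number

-- For `s ≥ 2` a larger exponent absorbs constants and sums, so no leading coefficient is carried.
PolyBounded : (ℕ → ℕ) → Set
PolyBounded f = ∃ λ b → ∀ s → 2 ℕ.≤ s → f s ℕ.≤ s ℕ.^ b

^-monoʳ : ∀ {s a b} → 2 ℕ.≤ s → a ℕ.≤ b → s ℕ.^ a ℕ.≤ s ℕ.^ b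
^-monoʳ {s@(suc _)} _ = ℕ.^-monoʳ-≤ s

n<2^n : ∀ n → n ℕ.< 2 ℕ.^ n
n<2^n zero    = s≤s z≤n
n<2^n (suc n) = ℕ.+-mono-≤-< (ℕ.m^n>0 2 n) (subst (n ℕ.<_) (sym (ℕ.+-identityʳ _)) (n<2^n n))

poly-const : ∀ k → PolyBounded λ _ → k
poly-const k = k , λ s 2≤s → ℕ.≤-trans (ℕ.<⇒≤ (n<2^n k)) (ℕ.^-monoˡ-≤ k 2≤s)

poly-id : PolyBounded id
poly-id = 1 , λ s _ → ℕ.≤-reflexive (sym (ℕ.^-identityʳ s))

poly-* : ∀ {f g} → PolyBounded f → PolyBounded g → PolyBounded λ s → f s ℕ.* g s
poly-* (a , ha) (b , hb) = a ℕ.+ b , λ s 2≤s →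
  ℕ.≤-trans (ℕ.*-mono-≤ (ha s 2≤s) (hb s 2≤s)) (ℕ.≤-reflexive (sym (ℕ.^-distribˡ-+-* s a b)))

poly-+ : ∀ {f g} → PolyBounded f → PolyBounded g → PolyBounded λ s → f s ℕ.+ g s
poly-+ (a , ha) (b , hb) = suc (a ℕ.+ b) , λ s 2≤s → ℕ.≤-trans
  (ℕ.+-mono-≤ (ℕ.≤-trans (ha s 2≤s) (^-monoʳ 2≤s (ℕ.m≤m+n a b)))
              (ℕ.≤-trans (hb s 2≤s) (^-monoʳ 2≤s (ℕ.m≤n+m b a))))
  (ℕ.≤-trans (ℕ.≤-reflexive (cong (s ℕ.^ (a ℕ.+ b) ℕ.+_) (sym (ℕ.+-identityʳ _))))
    (ℕ.*-monoˡ-≤ (s ℕ.^ (a ℕ.+ b)) 2≤s))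

poly-suc : ∀ {f} → PolyBounded f → PolyBounded (suc ∘ f)
poly-suc = poly-+ (poly-const 1)

poly-square : ∀ {f} k → PolyBounded f → PolyBounded λ s → fold (f s) square k
poly-square zero    h = h
poly-square (suc k) h = poly-* (poly-square k h) (poly-square k h)

poly-double : ∀ {f} k → PolyBounded f → PolyBounded λ s → fold (f s) (λ t → t ℕ.+ t) k
poly-double zero    h = h
poly-double (suc k) h = poly-+ (poly-double k h) (poly-double k h)

exponent-poly : ∀ {J : Set} (js : List J) complete r → PolyBounded (exponent js complete r)
exponent-poly js complete r = poly-* (poly-suc (poly-* (poly-const K) p₁)) p₁
  where
  K K₃ : ℕ
  K  = length (functions js complete r)
  K₃ = length (comparisons js complete r)
  p₃ : PolyBounded (size₃ js complete r)
  p₃ = poly-square K₃ (poly-suc (poly-+ poly-id (poly-const (square (2 ℕ.+ r)))))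
  p₁ : PolyBounded (size₁ js complete r)
  p₁ = poly-square K (poly-suc (poly-square K (poly-suc p₃)))

-- Squaring a power of 2 only doubles its exponent; hence the loss over all colours stays a constant
-- factor in the exponent.
fold-square-2^ : ∀ e k → fold (2 ℕ.^ e) square k ≡ 2 ℕ.^ fold e (λ t → t ℕ.+ t) k
fold-square-2^ e zero    = refl
fold-square-2^ e (suc k) = trans (cong square (fold-square-2^ e k))
  (sym (ℕ.^-distribˡ-+-* 2 (fold e (λ t → t ℕ.+ t) k) _))

cliqueBound-poly : ∀ r m p → ∃ λ b → ∀ s → 2 ℕ.≤ s → cliqueBound r m p s ℕ.≤ 2 ℕ.^ (s ℕ.^ suc b)
cliqueBound-poly r m p =
  let b , h = poly-double p (exponent-poly (families p m) ∈-families r)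
  in b , λ s 2≤s → ℕ.≤-trans (ℕ.≤-reflexive (fold-square-2^ _ p))
       (ℕ.^-monoʳ-≤ 2 (ℕ.≤-trans (h s 2≤s) (^-monoʳ 2≤s (ℕ.n≤1+n b))))

-- The search goes up from 2 and stops when `suc s` would be too large for `N`. At the start `s = 2`
-- nothing is known from below, so that case is kept apart.
largest-size : ∀ b N → ∃ λ s → 2 ℕ.≤ s × (s ≡ 2 ⊎ 2 ℕ.^ (s ℕ.^ suc b) ℕ.≤ N) × N ℕ.< 2 ℕ.^ (suc s ℕ.^ suc b)
largest-size b N = search N 2 (ℕ.m≤m+n N 2) ℕ.≤-refl (inj₁ refl)
  where
  search : ∀ fuel s → N ℕ.≤ fuel ℕ.+ s → 2 ℕ.≤ s → s ≡ 2 ⊎ 2 ℕ.^ (s ℕ.^ suc b) ℕ.≤ N →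
    ∃ λ s → 2 ℕ.≤ s × (s ≡ 2 ⊎ 2 ℕ.^ (s ℕ.^ suc b) ℕ.≤ N) × N ℕ.< 2 ℕ.^ (suc s ℕ.^ suc b)
  search zero s N≤ 2≤s h = s , 2≤s , h , ℕ.≤-<-trans N≤ (ℕ.<-trans (ℕ.n<1+n s)
    (ℕ.<-≤-trans (n<2^n (suc s)) (ℕ.^-monoʳ-≤ 2
      (ℕ.m≤m*n (suc s) (suc s ℕ.^ b) {{ℕ.>-nonZero (ℕ.m^n>0 (suc s) b)}}))))
  search (suc fuel) s N≤ 2≤s h with N ℕ.<? 2 ℕ.^ (suc s ℕ.^ suc b)
  ... | yes N< = s , 2≤s , h , N<
  ... | no N≮ = search fuel (suc s) (subst (N ℕ.≤_) (sym (ℕ.+-suc fuel s)) N≤)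
    (ℕ.m≤n⇒m≤1+n 2≤s) (inj₂ (ℕ.≮⇒≥ N≮))

^-cancelʳ-≤ : ∀ {m n} → 2 ℕ.^ m ℕ.≤ 2 ℕ.^ n → m ℕ.≤ n
^-cancelʳ-≤ {m} {n} h = ℕ.≮⇒≥ λ n<m → ℕ.<⇒≱ (ℕ.^-monoʳ-< 2 (s≤s (s≤s z≤n)) n<m) h

-- Given in lowest terms, so that the numerator and denominator read by `LogPower≤` compute.
1/suc : ℕ → ℚ
1/suc b = mkℚ (+ 1) b (1-coprimeTo (suc b))

logPower≤ : ∀ {N} b s → N ℕ.≤ 2 ℕ.^ (s ℕ.^ suc b) → LogPower≤ N (1/suc b) s
logPower≤ {N} b s N≤ u v _ 2^u≤N^v = subst₂ ℕ._≤_ (sym (ℕ.^-identityʳ u))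
  (cong (s ℕ.^ suc b ℕ.*_) (sym (ℕ.^-identityʳ v)))
  (^-cancelʳ-≤ (ℕ.≤-trans 2^u≤N^v (ℕ.≤-trans (ℕ.^-monoˡ-≤ v N≤)
    (ℕ.≤-reflexive (ℕ.^-*-assoc 2 (s ℕ.^ suc b) v)))))

-- Small cliques, decidability and the final bound

⊆∧∣∣≥⇒≡ : ∀ {N} {e C : Subset N} → e ⊆ C → ∣ C ∣ ℕ.≤ ∣ e ∣ → e ≡ C
⊆∧∣∣≥⇒≡ {e = e} e⊆C le = Subset.⊆-antisym e⊆C λ {x} x∈C → decidable-stable (x Subset.∈? e)
  λ x∉e → ℕ.<⇒≱ (Subset.p⊂q⇒∣p∣<∣q∣ (e⊆C , x , x∈C , x∉e)) le

module _ {r p N} (χ : Colouring r N p) where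

  -- A set of at most `r` vertices contains no edge other than itself.
  small-monochromatic : Fin p → ∀ C → ∣ C ∣ ℕ.≤ r → MonochromaticClique χ C
  small-monochromatic κ₀ C ∣C∣≤r with ∣ C ∣ ℕ.≟ r
  ... | yes ∣C∣≡r = let κ , κ∈ = nonempty χ C ∣C∣≡r
    in κ , λ e e⊆ ∣e∣≡r → subst (λ e → κ ∈ colours χ e)
      (sym (⊆∧∣∣≥⇒≡ e⊆ (subst (∣ C ∣ ℕ.≤_) (sym ∣e∣≡r) ∣C∣≤r))) κ∈
  ... | no ∣C∣≢r = κ₀ , λ e e⊆ ∣e∣≡r → contradiction
    (ℕ.≤-antisym ∣C∣≤r (subst (ℕ._≤ ∣ C ∣) ∣e∣≡r (Subset.p⊆q⇒∣p∣≤∣q∣ e⊆))) ∣C∣≢r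

  monochromatic? : ∀ C → Dec (MonochromaticClique χ C)
  monochromatic? C = Fin.any? λ κ →
    map′ (λ ∄e e e⊆ ∣e∣≡r → decidable-stable (κ Subset.∈? colours χ e)
                λ κ∉ → ∄e (e , (λ {x} → e⊆ {x}) , ∣e∣≡r , κ∉))
             (λ mono (e , e⊆ , ∣e∣≡r , κ∉) → κ∉ (mono e e⊆ ∣e∣≡r))
             (¬? (Subset.anySubset? λ e →
               e Subset.⊆? C ×-dec (∣ e ∣ ℕ.≟ r ×-dec ¬? (κ Subset.∈? colours χ e))))

  -- Subsets and colours can be searched exhaustively, so the double negation left by the signs is
  -- removed here.
  largeClique-stable : ∀ s → let P = ∃ λ C → MonochromaticClique χ C × s ℕ.≤ ∣ C ∣ in ¬ ¬ P → P
  largeClique-stable s = decidable-stable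
    (Subset.anySubset? λ C → monochromatic? C ×-dec s ℕ.≤? ∣ C ∣)

pair-clique : ∀ {p N} (χ : Colouring 1 N p) → p ℕ.< N →
  ∃ λ C → MonochromaticClique χ C × 2 ℕ.≤ ∣ C ∣
pair-clique {p} {N} χ p<N with Fin.pigeonhole p<N (λ x → proj₁ (nonempty χ ⁅ x ⁆ (Subset.∣⁅x⁆∣≡1 x)))
... | x , y , x<y , same = fromList (x ∷ y ∷ []) , (colour x , mono) ,
    increasing⇒≤∣setOf∣ {v = List.lookup (x ∷ y ∷ [])} (lookup-increasing ((x<y ∷ []) ∷ [] ∷ []))
  where
  colour : Fin N → Fin p
  colour x = proj₁ (nonempty χ ⁅ x ⁆ (Subset.∣⁅x⁆∣≡1 x))
  colour∈ : ∀ {z} → z ∈ₗ (x ∷ y ∷ []) → colour x ∈ colours χ ⁅ z ⁆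
  colour∈ (here refl)         = proj₂ (nonempty χ ⁅ x ⁆ (Subset.∣⁅x⁆∣≡1 x))
  colour∈ (there (here refl)) = subst (_∈ colours χ ⁅ y ⁆) (sym same)
    (proj₂ (nonempty χ ⁅ y ⁆ (Subset.∣⁅x⁆∣≡1 y)))
  mono : ∀ e → e ⊆ fromList (x ∷ y ∷ []) → ∣ e ∣ ≡ 1 → colour x ∈ colours χ e
  mono e e⊆ ∣e∣≡1 = subst (λ e → colour x ∈ colours χ e) singleton (colour∈ (∈-fromList⁻ _ (e⊆ z∈)))
    where
    E : Enumeration e 1
    E = subst (Enumeration e) ∣e∣≡1 (enumerate e)
    z : Fin N
    z = Enumeration.element E zero
    z∈ : z ∈ e
    z∈ = Enumeration.sound E zero
    singleton : ⁅ z ⁆ ≡ e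
    singleton = ⊆∧∣∣≥⇒≡ (λ w∈ → subst (_∈ e) (sym (Subset.x∈⁅y⁆⇒x≡y z w∈)) z∈)
      (ℕ.≤-reflexive (trans ∣e∣≡1 (sym (Subset.∣⁅x⁆∣≡1 z))))

-- For `r ≥ 2` any two vertices will do. For `r = 1` the edges are single vertices: with `N ≤ p` all
-- colours could differ and leave only one-vertex cliques, too small once `N ≥ 3`. The last
-- hypothesis excludes this, and the pigeonhole principle applies.
small-clique : ∀ {r p N} (χ : Colouring r N p) → 1 ℕ.≤ r → Fin p → 3 ℕ.≤ N →
  (r ≡ 1 → N ℕ.≤ 2 ⊎ p ℕ.< N) → ∃ λ C → MonochromaticClique χ C × 2 ℕ.≤ ∣ C ∣
small-clique {1} χ _ κ₀ 3≤N h with h refl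
... | inj₁ N≤2 = contradiction (ℕ.≤-trans 3≤N N≤2) λ { (s≤s (s≤s ())) }
... | inj₂ p<N = pair-clique χ p<N
small-clique {suc (suc r)} {N = suc (suc N)} χ _ κ₀ (s≤s (s≤s _)) h =
  C , small-monochromatic χ κ₀ C (subst (ℕ._≤ 2 ℕ.+ r) (sym ∣C∣≡2) (s≤s (s≤s z≤n))) ,
  ℕ.≤-reflexive (sym ∣C∣≡2)
  where
  C : Subset (2 ℕ.+ N)
  C = inside ∷ inside ∷ Subset.⊥
  ∣C∣≡2 : ∣ C ∣ ≡ 2
  ∣C∣≡2 = cong (2 ℕ.+_) (Subset.∣⊥∣≡0 N)

module _ {r′ d m p : ℕ} (κ₀ : Fin p) (b : ℕ)
  (bound : ∀ s → 2 ℕ.≤ s → cliqueBound (suc r′) m p s ℕ.≤ 2 ℕ.^ (s ℕ.^ suc b)) where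

  private
    r B : ℕ
    r = suc r′
    -- Twice the exponent, because `s + 1 ≤ s * s` is used to pass from the upper bound at `s + 1`
    -- to one at `s`.
    B = suc b ℕ.+ suc b

  clique : ∀ N → 1 ℕ.≤ N → (r ≡ 1 → N ℕ.≤ 2 ⊎ p ℕ.< N) → (χ : Colouring r N p) →
    (∀ κ → SemiAlgebraic d 1 m (colourClass χ κ)) → Dec (N ℕ.≤ 2) →
    ∃ λ (C : Subset N) → MonochromaticClique χ C × LogPower≤ N (1/suc B) ∣ C ∣
  -- Here the logarithm to base 2 is at most 1, and one vertex is enough.
  clique N@(suc _) _ h χ sa (yes N≤2) = ⁅ zero ⁆ ,
    small-monochromatic χ κ₀ ⁅ zero ⁆ (subst (ℕ._≤ r) (sym (Subset.∣⁅x⁆∣≡1 {N} zero)) (s≤s z≤n)) ,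
    subst (LogPower≤ N (1/suc B)) (sym (Subset.∣⁅x⁆∣≡1 {N} zero))
      (logPower≤ B 1 (ℕ.≤-trans N≤2 (ℕ.≤-reflexive (cong (2 ℕ.^_) (sym (ℕ.^-zeroˡ (suc B)))))))
  clique N _ h χ sa (no N≰2) =
    let s , 2≤s , s-large , N< = largest-size b N
        C , mono , s≤ = find-clique s 2≤s s-large
    in C , mono , logPower≤ B ∣ C ∣ (ℕ.≤-trans (ℕ.<⇒≤ N<) (ℕ.^-monoʳ-≤ 2
         (ℕ.≤-trans (power s 2≤s) (ℕ.^-monoˡ-≤ (suc B) s≤))))
    where
    find-clique : ∀ s → 2 ℕ.≤ s → s ≡ 2 ⊎ 2 ℕ.^ (s ℕ.^ suc b) ℕ.≤ N →
      ∃ λ C → MonochromaticClique χ C × s ℕ.≤ ∣ C ∣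
    find-clique _ _   (inj₁ refl) = small-clique χ (s≤s z≤n) κ₀ (ℕ.≰⇒> N≰2) h
    find-clique s 2≤s (inj₂ le) =
      largeClique-stable χ s (¬¬-clique χ sa s κ₀ (ℕ.≤-trans (bound s 2≤s) le))
    power : ∀ s → 2 ℕ.≤ s → suc s ℕ.^ suc b ℕ.≤ s ℕ.^ suc B
    power s 2≤s = ℕ.≤-trans (ℕ.^-monoˡ-≤ (suc b) suc-s≤) (ℕ.≤-trans
      (ℕ.≤-reflexive (trans (cong (ℕ._^ suc b) (cong (s ℕ.*_) (sym (ℕ.^-identityʳ s))))
        (trans (ℕ.^-*-assoc s 2 (suc b)) (cong (s ℕ.^_) (cong (suc b ℕ.+_) (ℕ.+-identityʳ (suc b)))))))
      (^-monoʳ 2≤s (ℕ.n≤1+n B)))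
      where
      suc-s≤ : suc s ℕ.≤ s ℕ.* s
      suc-s≤ = ℕ.≤-trans (ℕ.+-monoˡ-≤ s (ℕ.≤-trans (s≤s z≤n) 2≤s))
        (ℕ.≤-trans (ℕ.≤-reflexive (cong (s ℕ.+_) (sym (ℕ.+-identityʳ s)))) (ℕ.*-monoˡ-≤ s 2≤s))

theorem5 : ∀ (r d m p : ℕ) → 1 ℕ.≤ r → 1 ℕ.≤ d → 1 ℕ.≤ m → 1 ℕ.≤ p →
    ∃ λ (c : ℚ) → 0ℚ ℚ.< c ×
    (∀ (N : ℕ) → 1 ℕ.≤ N → (r ≡ 1 → N ℕ.≤ 2 ⊎ p ℕ.< N) →
    ∀ (χ : Colouring r N p) →
    (∀ (κ : Fin p) → SemiAlgebraic d 1 m (colourClass χ κ)) →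
    ∃ λ (C : Subset N) → MonochromaticClique χ C × LogPower≤ N c ∣ C ∣)
theorem5 (suc r′) d m p@(suc _) _ _ _ _ =
  let b , bound = cliqueBound-poly (suc r′) m p
  in 1/suc (suc b ℕ.+ suc b) , ℚ.positive⁻¹ _ ,
     λ N 1≤N h χ sa → clique {r′} {d} {m} {p} zero b bound N 1≤N h χ sa (N ℕ.≤? 2)
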